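{- Let $M$ be a $\lambda$-term. If $\mathsf{T_Q}(M)=([x_1:\vec\tau_1,\dots,x_n:\vec\tau_n],\sigma,b)$, then there exist a measure $b'$, a rank 2 multi-type $s$ and rank 1 multi-types $\vec t_1,\dots,\vec t_n$ such that $[x_1:(\vec\tau_1,\vec t_1),\dots,x_n:(\vec\tau_n,\vec t_n)]\vdash^{b'}M:(\sigma,s)$.
   Context: Terms are untyped $\lambda$-terms modulo $\alpha$-equivalence, with Barendregt's variable convention. $M[N/x]$ is the usual substitution, and $M[x/x_1,x/x_2]$ means $(M[x/x_1])[x/x_2]$. **Types.** $\mathbb{V}$ is a countably infinite set of type variables $\alpha$. Linear types $\tau\in\mathbb{T}_{L0}$: $\tau::=\alpha\mid\tau\multimap\tau$. Sequences $\vec\tau\in\mathbb{T}_{L1}$: $\tau_1\cap\dots\cap\tau_m$, $m\ge1$. Linear rank 2 types $\sigma\in\mathbb{T}_{L2}$: $\sigma::=\tau\mid\tau\multimap\sigma\mid\tau_1\cap\dots\cap\tau_m\to\sigma$ with $m\ge2$. Multi-types: tight constants $\mathsf{tight}::=\mathsf{Neutral}\mid\mathsf{Abs}$; rank 0: $t::=\mathsf{tight}\mid\alpha\mid t\multimap t$; rank 1: $\vec t::=t\mid\vec t\cap\vec t$; rank 2: $s::=t\mid t\multimap s\mid\vec t\to s$. The constructor $\cap$ is associative, commutative and non-idempotent. $\mathsf{tight}(t_1\cap\dots\cap t_n)$ holds iff every $t_i$ is a tight constant. **Environments.** An environment is a finite list $\Gamma=[x_1:(\vec\tau_1,\vec t_1),\dots,x_n:(\vec\tau_n,\vec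 t_n)]$ with pairwise distinct variables $x_i$ (consistency), $\mathrm{dom}(\Gamma)=\{x_1,\dots,x_n\}$. A $\mathbb{T}_{L1}$-environment is the same with only the first components: $[x_1:\vec\tau_1,\dots,x_n:\vec\tau_n]$. Comma is list concatenation. $\Gamma_x$ is $\Gamma$ with the declaration of $x$ (if any) removed. $\Gamma_1+\Gamma_2$ has domain $\mathrm{dom}(\Gamma_1)\cup\mathrm{dom}(\Gamma_2)$, agrees with $\Gamma_1$ (resp. $\Gamma_2$) on variables declared only there, and for $x$ declared in both intersects the predicates componentwise ($(\vec\tau_1\cap\vec\tau_2,\vec t_1\cap\vec t_2)$, resp. $\vec\tau_1\cap\vec\tau_2$ for $\mathbb{T}_{L1}$-environments); declarations of variables of $\Gamma_1$ come first in their order, then the remaining ones in the order of $\Gamma_2$. $\sum$ is iterated $+$. **Linear Rank 2 Quantitative Type System.** Judgments $\Gamma\vdash^{b}M:(\sigma,s)$, $b\in\mathbb{N}$, are derived by the following rules (all lists must be environments; each occurrence of $\mathsf{tight}$ stands for some tight constant): - (Axiom) $[x:(\tau,t)]\vdash^0x:(\tau,t)$. - (Exchange) two adjacent declarations of the environment may be swapped, keeping $b,M,\sigma,s$. - (Contraction) from $\Gamma_1,x_1:(\vec\tau_1,\vec t_1),x_2:(\vec\tau_2,\vec t_2),\Gamma_2\vdash^bM:(\sigma,s)$ infer $\Gamma_1,x:(\vec\tau_1\cap\vec\tau_2,\vec t_1\cap\vec t_2),\Gamma_2\vdash^bM[x/x_1,x/x_2]:(\sigma,s)$. - ($\multimap$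 Intro) from $\Gamma,x:(\tau,t)\vdash^bM:(\sigma,s)$ infer $\Gamma\vdash^{b+1}\lambda x.M:(\tau\multimap\sigma,t\multimap s)$. - ($\multimap$ Intro$_t$) from $\Gamma,x:(\tau,\mathsf{tight})\vdash^bM:(\sigma,\mathsf{tight})$ infer $\Gamma\vdash^b\lambda x.M:(\tau\multimap\sigma,\mathsf{Abs})$. - ($\to$ Intro) from $\Gamma,x:(\tau_1\cap\dots\cap\tau_n,t_1\cap\dots\cap t_n)\vdash^bM:(\sigma,s)$, $n\ge2$, infer $\Gamma\vdash^{b+1}\lambda x.M:(\tau_1\cap\dots\cap\tau_n\to\sigma,t_1\cap\dots\cap t_n\to s)$. - ($\to$ Intro$_t$) from $\Gamma,x:(\tau_1\cap\dots\cap\tau_n,\vec t)\vdash^bM:(\sigma,\mathsf{tight})$, $\mathsf{tight}(\vec t)$, $n\ge2$, infer $\Gamma\vdash^b\lambda x.M:(\tau_1\cap\dots\cap\tau_n\to\sigma,\mathsf{Abs})$. - ($\multimap$ Elim) from $\Gamma_1\vdash^{b_1}M_1:(\tau\multimap\sigma,t\multimap s)$ and $\Gamma_2\vdash^{b_2}M_2:(\tau,t)$ infer $\Gamma_1,\Gamma_2\vdash^{b_1+b_2}M_1M_2:(\sigma,s)$. - ($\multimap$ Elim$_t$) from $\Gamma_1\vdash^{b_1}M_1:(\tau\multimap\sigma,\mathsf{Neutral})$ and $\Gamma_2\vdash^{b_2}M_2:(\tau,\mathsf{tight})$ infer $\Gamma_1,\Gamma_2\vdash^{b_1+b_2}M_1M_2:(\sigma,\mathsf{Neutral})$.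 - ($\to$ Elim) from $\Gamma\vdash^bM_1:(\tau_1\cap\dots\cap\tau_n\to\sigma,t_1\cap\dots\cap t_n\to s)$ and $\Gamma_i\vdash^{b_i}M_2:(\tau_i,t_i)$ for $1\le i\le n$, $n\ge2$, infer $\Gamma,\sum_{i=1}^n\Gamma_i\vdash^{b+b_1+\dots+b_n}M_1M_2:(\sigma,s)$. - ($\to$ Elim$_t$) from $\Gamma\vdash^bM_1:(\tau_1\cap\dots\cap\tau_n\to\sigma,\mathsf{Neutral})$ and $\Gamma_i\vdash^{b_i}M_2:(\tau_i,\mathsf{tight})$ for $1\le i\le n$, $n\ge2$, infer $\Gamma,\sum_{i=1}^n\Gamma_i\vdash^{b+b_1+\dots+b_n}M_1M_2:(\sigma,\mathsf{Neutral})$. **Type substitutions and quantitative unification.** A type substitution $\mathbb{S}=[\tau_1/\alpha_1,\dots,\tau_n/\alpha_n]$ (distinct $\alpha_i$, $\tau_i\in\mathbb{T}_{L0}$) acts by simultaneous replacement on types, sequences and $\mathbb{T}_{L1}$-environments. A unification problem $P$ is a finite set of equations between types of $\mathbb{T}_{L0}$. The relation $\Rightarrow$ is: $\{\tau=\tau\}\cup P\Rightarrow P$; (*) $\{\tau_1\multimap\tau_2=\tau_3\multimap\tau_4\}\cup P\Rightarrow\{\tau_1=\tau_3,\tau_2=\tau_4\}\cup P$; $\{\tau_1\multimap\tau_2=\alpha\}\cup P\Rightarrow\{\alpha=\tau_1\multimap\tau_2\}\cup P$; $\{\alpha=\tau\}\cup P\Rightarrow\{\alpha=\tau\}\cup P[\tau/\alpha]$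 if $\alpha$ occurs in $P$ and not in $\tau$; $\{\alpha=\tau\}\cup P\Rightarrow\mathsf{FAIL}$ if $\alpha$ occurs in $\tau$ and $\alpha\ne\tau$. $\mathsf{UNIFY_Q}(P)$ applies $\Rightarrow$ as long as possible, counting in $b$ the number of steps of form (*); if the result is a solved form $\{\alpha_1=\tau_1,\dots,\alpha_n=\tau_n\}$ ($\alpha_i$ pairwise distinct, occurring in no $\tau_j$) it returns $([\tau_1/\alpha_1,\dots,\tau_n/\alpha_n],b)$ (the substitution being a most general unifier of the original problem), otherwise it fails. **Quantitative type inference algorithm $\mathsf{T_Q}$**, returning a $\mathbb{T}_{L1}$-environment, a type in $\mathbb{T}_{L2}$ and a measure. "New" type variables are fresh; separate recursive calls use different fresh variables; results are considered up to renaming of type variables. 1. $\mathsf{T_Q}(x)=([x:\alpha],\alpha,0)$, $\alpha$ new. 2. If $M=\lambda x.M_1$ and $\mathsf{T_Q}(M_1)=(\Gamma_1,\sigma_1,b_1)$: (a) if $x\notin\mathrm{dom}(\Gamma_1)$, fail; (b) if $(x:\tau)\in\Gamma_1$, $\mathsf{T_Q}(M)=((\Gamma_1)_x,\tau\multimap\sigma_1,b_1)$; (c) if $(x:\tau_1\cap\dots\cap\tau_n)\in\Gamma_1$ with $n\ge2$, $\mathsf{T_Q}(M)=((\Gamma_1)_x,\tau_1\cap\dots\cap\tau_n\to\sigma_1,b_1)$. 3. If $M=M_1M_2$: (a) if $\mathsf{T_Q}(M_1)=(\Gamma_1,\alpha_1,b_1)$ and $\mathsf{T_Q}(M_2)=(\Gamma_2,\tau_2,b_2)$,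 then $\mathsf{T_Q}(M)=(\mathbb{S}(\Gamma_1+\Gamma_2),\mathbb{S}(\alpha_3),b_1+b_2)$ with $(\mathbb{S},\_)=\mathsf{UNIFY_Q}(\{\alpha_1=\alpha_2\multimap\alpha_3,\tau_2=\alpha_2\})$, $\alpha_2,\alpha_3$ new; (b) if $\mathsf{T_Q}(M_1)=(\Gamma_1',\tau_1'\cap\dots\cap\tau_n'\to\sigma_1',b_1)$ with $n\ge2$ and, for each $1\le i\le n$, $\mathsf{T_Q}(M_2)=(\Gamma_i,\tau_i,b_i)$ ($n$ separate calls), then $\mathsf{T_Q}(M)=(\mathbb{S}(\Gamma_1'+\sum_{i=1}^n\Gamma_i),\mathbb{S}(\sigma_1'),b_1+\sum_{i=1}^nb_i+b_3+1)$ with $(\mathbb{S},b_3)=\mathsf{UNIFY_Q}(\{\tau_i=\tau_i'\mid1\le i\le n\})$ (here the first summand $b_1$ is the measure of $M_1$, the $b_i$ in the sum are those of the calls on $M_2$, and $b_3$ is the unification count); (c) if $\mathsf{T_Q}(M_1)=(\Gamma_1,\tau\multimap\sigma_1,b_1)$ and $\mathsf{T_Q}(M_2)=(\Gamma_2,\tau_2,b_2)$, then $\mathsf{T_Q}(M)=(\mathbb{S}(\Gamma_1+\Gamma_2),\mathbb{S}(\sigma_1),b_1+b_2+b_3+1)$ with $(\mathbb{S},b_3)=\mathsf{UNIFY_Q}(\{\tau_2=\tau\})$; (d) otherwise fail. If a recursive call or a unification fails, the algorithm fails. $\mathsf{T_Q}(M)=(\Gamma,\sigma,b)$ means that the algorithm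 succeeds with this result. -}

module Defs where

open import Data.Nat using (ℕ; zero; suc; _+_; _≟_)
open import Data.Fin using (Fin; fromℕ; inject₁)
open import Data.Maybe using (Maybe; just; nothing; maybe′)
open import Data.Product using (∃; ∃-syntax; _×_; _,_; proj₁; proj₂)
open import Data.Product.Relation.Binary.Pointwise.NonDependent renaming (Pointwise to _×ᴿ_)
open import Data.Sum using (_⊎_)
open import Data.Vec using (Vec; lookup)
import Data.Vec as Vec
open import Data.List using (List; []; _∷_; [_]; _++_; map; filter)
open import Data.List.NonEmpty using (List⁺; _∷_; _⁺++⁺_; fromVec)
import Data.List.NonEmpty as List⁺
open import Data.List.Membership.Propositional using (_∈_; _∉_)
open import Data.List.Membership.DecPropositional _≟_ using (_∈?_)
open import Data.List.Relation.Unary.All using (All)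
open import Data.List.Relation.Unary.Any using (Any)
open import Data.List.Relation.Unary.Unique.Propositional using (Unique)
open import Data.List.Relation.Binary.Pointwise using (Pointwise)
open import Data.List.Relation.Binary.Permutation.Propositional using (_↭_)
open import Data.List.Relation.Binary.BagAndSetEquality using (_∼[_]_; set)
open import Relation.Nullary using (¬_; yes; no)
open import Relation.Nullary.Decidable using (¬?)
open import Relation.Binary.PropositionalEquality using (_≡_; _≢_)

Var TVar : Set
Var  = ℕ
TVar = ℕ

-- Locally nameless terms: free variables are named and bound ones are
-- de Bruijn indices, so elements of Λ are exactly the λ-terms modulo α.

data Term (n : ℕ) : Set where
  free  : Var → Term n
  bound : Fin n → Term n
  ƛ_    : Term (suc n) → Term n
  _·_   : Term n → Term n → Term n

infixl 7 _·_

Λ : Set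
Λ = Term 0

-- Binds the name x with a new outermost binder, whose index is the largest.

close : ∀ {n} → Var → Term n → Term (suc n)
close {n} x (free y) with y ≟ x
... | yes _ = bound (fromℕ n)
... | no  _ = free y
close x (bound i) = bound (inject₁ i)
close x (ƛ M)     = ƛ close x M
close x (M · N)   = close x M · close x N

lam : Var → Λ → Λ
lam x M = ƛ close x M

-- M [ y / x ] puts the variable y for the free occurrences of x.

_[_/_] : ∀ {n} → Term n → Var → Var → Term n
free z [ y / x ] with z ≟ x
... | yes _ = free y
... | no  _ = free z
bound i [ y / x ] = bound i
(ƛ M)   [ y / x ] = ƛ (M [ y / x ])
(M · N) [ y / x ] = (M [ y / x ]) · (N [ y / x ])

infixl 8 _[_/_]

infixr 7 _⊸_ _⇒_

data LTy : Set where
  var : TVar → LTy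
  _⊸_ : LTy → LTy → LTy

-- Intersections are non-empty lists, taken up to permutation in _≈ˢ_ below.

LSeq : Set
LSeq = List⁺ LTy

-- In the grammar  σ ::= τ | τ ⊸ σ | τ₁ ∩ ⋯ ∩ τₘ → σ  the type τ ⊸ τ′ arises
-- in two ways. Here it has one representation: a linear type is included
-- in LTy₂ through ⌈_⌉.

data LTy₂ : Set where
  var : TVar → LTy₂
  _⊸_ : LTy → LTy₂ → LTy₂
  _⇒_ : ∀ {n} → Vec LTy (2 + n) → LTy₂ → LTy₂

⌈_⌉ : LTy → LTy₂
⌈ var α ⌉  = var α
⌈ τ ⊸ τ′ ⌉ = τ ⊸ ⌈ τ′ ⌉

data Tight : Set where
  Neutral Abs : Tight

data MTy : Set where
  tight : Tight → MTy
  var   : TVar → MTy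
  _⊸_   : MTy → MTy → MTy

MSeq : Set
MSeq = List⁺ MTy

data MTy₂ : Set where
  tight : Tight → MTy₂
  var   : TVar → MTy₂
  _⊸_   : MTy → MTy₂ → MTy₂
  _⇒_   : MSeq → MTy₂ → MTy₂

⌈_⌉ᵐ : MTy → MTy₂
⌈ tight c ⌉ᵐ = tight c
⌈ var α ⌉ᵐ   = var α
⌈ t ⊸ t′ ⌉ᵐ  = t ⊸ ⌈ t′ ⌉ᵐ

AllTight : MSeq → Set
AllTight t⃗ = All (λ t → ∃[ c ] t ≡ tight c) (List⁺.toList t⃗)

infix 4 _≈ˢ_ _≈_ _≈ᵐ_

_≈ˢ_ : {A : Set} → List⁺ A → List⁺ A → Set
as ≈ˢ bs = List⁺.toList as ↭ List⁺.toList bs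

data _≈_ : LTy₂ → LTy₂ → Set where
  var : ∀ {α} → var α ≈ var α
  _⊸_ : ∀ τ {σ σ′} → σ ≈ σ′ → (τ ⊸ σ) ≈ (τ ⊸ σ′)
  _⇒_ : ∀ {m n} {τs : Vec LTy (2 + m)} {τs′ : Vec LTy (2 + n)} {σ σ′} →
        fromVec τs ≈ˢ fromVec τs′ → σ ≈ σ′ → (τs ⇒ σ) ≈ (τs′ ⇒ σ′)

data _≈ᵐ_ : MTy₂ → MTy₂ → Set where
  tight : ∀ {c} → tight c ≈ᵐ tight c
  var   : ∀ {α} → var α ≈ᵐ var α
  _⊸_   : ∀ t {s s′} → s ≈ᵐ s′ → (t ⊸ s) ≈ᵐ (t ⊸ s′)
  _⇒_   : ∀ {t⃗ t⃗′ s s′} → t⃗ ≈ˢ t⃗′ → s ≈ᵐ s′ → (t⃗ ⇒ s) ≈ᵐ (t⃗′ ⇒ s′)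

assoc : {A : Set} → ℕ → List (ℕ × A) → Maybe A
assoc x [] = nothing
assoc x ((y , a) ∷ Γ) with x ≟ y
... | yes _ = just a
... | no  _ = assoc x Γ

Decls : Set → Set
Decls A = List (Var × A)

dom : {A : Set} → Decls A → List Var
dom = map proj₁

Consistent : {A : Set} → Decls A → Set
Consistent Γ = Unique (dom Γ)

infixl 6 _∖_

_∖_ : {A : Set} → Decls A → Var → Decls A
Γ ∖ x = filter (λ d → ¬? (proj₁ d ≟ x)) Γ

merge : {A : Set} → (A → A → A) → Decls A → Decls A → Decls A
merge _∩_ Γ₁ Γ₂ =
  map (λ (x , a) → x , maybe′ (a ∩_) a (assoc x Γ₂)) Γ₁
  ++ filter (λ d → ¬? (proj₁ d ∈? dom Γ₁)) Γ₂

LEnv : Set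
LEnv = Decls LSeq

Env : Set
Env = Decls (LSeq × MSeq)

infixl 6 _⊕ᴸ_ _⊕_

_⊕ᴸ_ : LEnv → LEnv → LEnv
_⊕ᴸ_ = merge _⁺++⁺_

_⊕_ : Env → Env → Env
_⊕_ = merge (λ (τ⃗₁ , t⃗₁) (τ⃗₂ , t⃗₂) → τ⃗₁ ⁺++⁺ τ⃗₂ , t⃗₁ ⁺++⁺ t⃗₂)

∑ᴸ : ∀ {n} → Vec LEnv n → LEnv
∑ᴸ = Vec.foldr′ _⊕ᴸ_ []

∑ : ∀ {n} → Vec Env n → Env
∑ = Vec.foldr′ _⊕_ []

infix 4 _≈ᴸᴱ_ _≈ᴱ_

_≈ᴸᴱ_ : LEnv → LEnv → Set
_≈ᴸᴱ_ = Pointwise (_≡_ ×ᴿ _≈ˢ_)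

_≈ᴱ_ : Env → Env → Set
_≈ᴱ_ = Pointwise (_≡_ ×ᴿ (_≈ˢ_ ×ᴿ _≈ˢ_))

infix 3 _⊢[_]_∶_

-- Consistency is required where a rule could break it; the other rules
-- preserve it. The rule conv makes the judgment one about types modulo
-- commutativity of ∩.

data _⊢[_]_∶_ : Env → ℕ → Λ → LTy₂ × MTy₂ → Set where

  axiom : ∀ {x τ t} →
    [ x , List⁺.[ τ ] , List⁺.[ t ] ] ⊢[ 0 ] free x ∶ (⌈ τ ⌉ , ⌈ t ⌉ᵐ)

  exchange : ∀ Γ₁ {d₁ d₂ Γ₂ b M σ s} →
    Γ₁ ++ d₁ ∷ d₂ ∷ Γ₂ ⊢[ b ] M ∶ (σ , s) →
    Γ₁ ++ d₂ ∷ d₁ ∷ Γ₂ ⊢[ b ] M ∶ (σ , s)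

  contraction : ∀ Γ₁ {Γ₂ x x₁ x₂ τ⃗₁ τ⃗₂ t⃗₁ t⃗₂ b M σ s} →
    Γ₁ ++ (x₁ , τ⃗₁ , t⃗₁) ∷ (x₂ , τ⃗₂ , t⃗₂) ∷ Γ₂ ⊢[ b ] M ∶ (σ , s) →
    Consistent (Γ₁ ++ (x , τ⃗₁ ⁺++⁺ τ⃗₂ , t⃗₁ ⁺++⁺ t⃗₂) ∷ Γ₂) →
    Γ₁ ++ (x , τ⃗₁ ⁺++⁺ τ⃗₂ , t⃗₁ ⁺++⁺ t⃗₂) ∷ Γ₂ ⊢[ b ] M [ x / x₁ ] [ x / x₂ ] ∶ (σ , s)

  ⊸-intro : ∀ {Γ x τ t b M σ s} →
    Γ ++ [ x , List⁺.[ τ ] , List⁺.[ t ] ] ⊢[ b ] M ∶ (σ , s) →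
    Γ ⊢[ suc b ] lam x M ∶ (τ ⊸ σ , t ⊸ s)

  ⊸-introₜ : ∀ {Γ x τ c c′ b M σ} →
    Γ ++ [ x , List⁺.[ τ ] , List⁺.[ tight c ] ] ⊢[ b ] M ∶ (σ , tight c′) →
    Γ ⊢[ b ] lam x M ∶ (τ ⊸ σ , tight Abs)

  ⇒-intro : ∀ {n Γ x} {τs : Vec LTy (2 + n)} {ts : Vec MTy (2 + n)} {b M σ s} →
    Γ ++ [ x , fromVec τs , fromVec ts ] ⊢[ b ] M ∶ (σ , s) →
    Γ ⊢[ suc b ] lam x M ∶ (τs ⇒ σ , fromVec ts ⇒ s)

  ⇒-introₜ : ∀ {n Γ x} {τs : Vec LTy (2 + n)} {t⃗ c b M σ} →
    Γ ++ [ x , fromVec τs , t⃗ ] ⊢[ b ] M ∶ (σ , tight c) →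
    AllTight t⃗ →
    Γ ⊢[ b ] lam x M ∶ (τs ⇒ σ , tight Abs)

  ⊸-elim : ∀ {Γ₁ Γ₂ b₁ b₂ M₁ M₂ τ t σ s} →
    Γ₁ ⊢[ b₁ ] M₁ ∶ (τ ⊸ σ , t ⊸ s) →
    Γ₂ ⊢[ b₂ ] M₂ ∶ (⌈ τ ⌉ , ⌈ t ⌉ᵐ) →
    Consistent (Γ₁ ++ Γ₂) →
    Γ₁ ++ Γ₂ ⊢[ b₁ + b₂ ] M₁ · M₂ ∶ (σ , s)

  ⊸-elimₜ : ∀ {Γ₁ Γ₂ b₁ b₂ M₁ M₂ τ c σ} →
    Γ₁ ⊢[ b₁ ] M₁ ∶ (τ ⊸ σ , tight Neutral) →
    Γ₂ ⊢[ b₂ ] M₂ ∶ (⌈ τ ⌉ , tight c) →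
    Consistent (Γ₁ ++ Γ₂) →
    Γ₁ ++ Γ₂ ⊢[ b₁ + b₂ ] M₁ · M₂ ∶ (σ , tight Neutral)

  ⇒-elim : ∀ {n Γ b M₁ M₂ σ s} {τs : Vec LTy (2 + n)} {ts : Vec MTy (2 + n)}
    {Γs : Vec Env (2 + n)} {bs : Vec ℕ (2 + n)} →
    Γ ⊢[ b ] M₁ ∶ (τs ⇒ σ , fromVec ts ⇒ s) →
    (∀ i → lookup Γs i ⊢[ lookup bs i ] M₂ ∶ (⌈ lookup τs i ⌉ , ⌈ lookup ts i ⌉ᵐ)) →
    Consistent (Γ ++ ∑ Γs) →
    Γ ++ ∑ Γs ⊢[ b + Vec.sum bs ] M₁ · M₂ ∶ (σ , s)

  ⇒-elimₜ : ∀ {n Γ b M₁ M₂ σ} {τs : Vec LTy (2 + n)} {cs : Vec Tight (2 + n)}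
    {Γs : Vec Env (2 + n)} {bs : Vec ℕ (2 + n)} →
    Γ ⊢[ b ] M₁ ∶ (τs ⇒ σ , tight Neutral) →
    (∀ i → lookup Γs i ⊢[ lookup bs i ] M₂ ∶ (⌈ lookup τs i ⌉ , tight (lookup cs i))) →
    Consistent (Γ ++ ∑ Γs) →
    Γ ++ ∑ Γs ⊢[ b + Vec.sum bs ] M₁ · M₂ ∶ (σ , tight Neutral)

  conv : ∀ {Γ Γ′ b M σ σ′ s s′} →
    Γ ⊢[ b ] M ∶ (σ , s) →
    Γ ≈ᴱ Γ′ → σ ≈ σ′ → s ≈ᵐ s′ →
    Γ′ ⊢[ b ] M ∶ (σ′ , s′)

-- The pair (α , τ) stands for τ / α; the keys are pairwise distinct in
-- the substitutions produced by unification.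

Subst : Set
Subst = List (TVar × LTy)

subᵛ : Subst → TVar → LTy
subᵛ S α = maybe′ (λ τ → τ) (var α) (assoc α S)

sub : Subst → LTy → LTy
sub S (var α)  = subᵛ S α
sub S (τ ⊸ τ′) = sub S τ ⊸ sub S τ′

sub₂ : Subst → LTy₂ → LTy₂
sub₂ S (var α)  = ⌈ subᵛ S α ⌉
sub₂ S (τ ⊸ σ)  = sub S τ ⊸ sub₂ S σ
sub₂ S (τs ⇒ σ) = Vec.map (sub S) τs ⇒ sub₂ S σ

subᴱ : Subst → LEnv → LEnv
subᴱ S = map (λ (x , τ⃗) → x , List⁺.map (sub S) τ⃗)

infix 6 _≐_

record Equation : Set where
  constructor _≐_
  field
    lhs rhs : LTy

-- Problems are finite sets: lists compared with _∼[ set ]_.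

Problem : Set
Problem = List Equation

_occursIn_ : TVar → LTy → Set
α occursIn var β    = α ≡ β
α occursIn (τ ⊸ τ′) = α occursIn τ ⊎ α occursIn τ′

_occursInᴾ_ : TVar → Problem → Set
α occursInᴾ P = Any (λ (l ≐ r) → α occursIn l ⊎ α occursIn r) P

subᴾ : Subst → Problem → Problem
subᴾ S = map (λ (l ≐ r) → sub S l ≐ sub S r)

-- Contract e P k Q: the equation e, in the context of the remaining
-- equations P, is rewritten giving Q, or FAIL if Q is nothing; k is 1 for
-- a decomposition and 0 otherwise.

data Contract : Equation → Problem → ℕ → Maybe Problem → Set where
  delete    : ∀ {τ P} → Contract (τ ≐ τ) P 0 (just P)
  decompose : ∀ {τ₁ τ₂ τ₃ τ₄ P} →
              Contract (τ₁ ⊸ τ₂ ≐ τ₃ ⊸ τ₄) P 1 (just (τ₁ ≐ τ₃ ∷ τ₂ ≐ τ₄ ∷ P))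
  orient    : ∀ {τ₁ τ₂ α P} →
              Contract (τ₁ ⊸ τ₂ ≐ var α) P 0 (just (var α ≐ τ₁ ⊸ τ₂ ∷ P))
  eliminate : ∀ {α τ P} → α occursInᴾ P → ¬ (α occursIn τ) →
              Contract (var α ≐ τ) P 0 (just (var α ≐ τ ∷ subᴾ [ α , τ ] P))
  fail      : ∀ {α τ P} → α occursIn τ → var α ≢ τ →
              Contract (var α ≐ τ) P 0 nothing

-- In {e} ∪ P the union is disjoint: otherwise delete could leave the
-- problem unchanged and decompose could be counted any number of times.

_⟶[_]_ : Problem → ℕ → Maybe Problem → Set
P ⟶[ k ] Q = ∃[ e ] ∃[ P′ ] P ∼[ set ] (e ∷ P′) × e ∉ P′ × Contract e P′ k Q

data _⟶*[_]_ : Problem → ℕ → Problem → Set where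
  done : ∀ {P} → P ⟶*[ 0 ] P
  step : ∀ {P Q R k b} → P ⟶[ k ] just Q → Q ⟶*[ b ] R → P ⟶*[ k + b ] R

equations : Subst → Problem
equations = map (λ (α , τ) → var α ≐ τ)

Solved : Subst → Set
Solved S = Unique (map proj₁ S) ×
  (∀ {α τ} → α ∈ map proj₁ S → τ ∈ map proj₂ S → ¬ (α occursIn τ))

-- No step applies to a solved form, so reaching one means that the steps
-- have been applied as long as possible.

UnifyQ : Problem → Subst → ℕ → Set
UnifyQ P S b = ∃[ Q ] P ⟶*[ b ] Q × Q ∼[ set ] equations S × Solved S

-- Infer M V Γ σ b: a successful run on M, in which the new type variables
-- were those in V, returns (Γ , σ , b). The Unique conditions say that
-- new variables are distinct from each other and from those of other
-- calls. A failing run is one for which no rule applies.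

data Infer : Λ → List TVar → LEnv → LTy₂ → ℕ → Set where

  fvar : ∀ {x α} →
    Infer (free x) [ α ] [ x , List⁺.[ var α ] ] (var α) 0

  abs-⊸ : ∀ {x M₁ V Γ₁ τ σ₁ b₁} →
    Infer M₁ V Γ₁ σ₁ b₁ →
    (x , List⁺.[ τ ]) ∈ Γ₁ →
    Infer (lam x M₁) V (Γ₁ ∖ x) (τ ⊸ σ₁) b₁

  abs-⇒ : ∀ {n x M₁ V Γ₁} {τs : Vec LTy (2 + n)} {σ₁ b₁} →
    Infer M₁ V Γ₁ σ₁ b₁ →
    (x , fromVec τs) ∈ Γ₁ →
    Infer (lam x M₁) V (Γ₁ ∖ x) (τs ⇒ σ₁) b₁

  app-var : ∀ {M₁ M₂ V₁ V₂ Γ₁ Γ₂ α₁ α₂ α₃ τ₂ b₁ b₂ S b₃} →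
    Infer M₁ V₁ Γ₁ (var α₁) b₁ →
    Infer M₂ V₂ Γ₂ ⌈ τ₂ ⌉ b₂ →
    Unique (V₁ ++ V₂ ++ α₂ ∷ α₃ ∷ []) →
    UnifyQ (var α₁ ≐ var α₂ ⊸ var α₃ ∷ τ₂ ≐ var α₂ ∷ []) S b₃ →
    Infer (M₁ · M₂) (V₁ ++ V₂ ++ α₂ ∷ α₃ ∷ [])
      (subᴱ S (Γ₁ ⊕ᴸ Γ₂)) (sub₂ S (var α₃)) (b₁ + b₂)

  app-⇒ : ∀ {n M₁ M₂ V₁ Γ₁} {τs′ : Vec LTy (2 + n)} {σ₁ b₁}
    {Vs : Vec (List TVar) (2 + n)} {Γs : Vec LEnv (2 + n)}
    {τs : Vec LTy (2 + n)} {bs : Vec ℕ (2 + n)} {S b₃} →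
    Infer M₁ V₁ Γ₁ (τs′ ⇒ σ₁) b₁ →
    (∀ i → Infer M₂ (lookup Vs i) (lookup Γs i) ⌈ lookup τs i ⌉ (lookup bs i)) →
    Unique (V₁ ++ Vec.foldr′ _++_ [] Vs) →
    UnifyQ (Vec.toList (Vec.zipWith _≐_ τs τs′)) S b₃ →
    Infer (M₁ · M₂) (V₁ ++ Vec.foldr′ _++_ [] Vs)
      (subᴱ S (Γ₁ ⊕ᴸ ∑ᴸ Γs)) (sub₂ S σ₁) (b₁ + Vec.sum bs + b₃ + 1)

  app-⊸ : ∀ {M₁ M₂ V₁ V₂ Γ₁ Γ₂ τ τ₂ σ₁ b₁ b₂ S b₃} →
    Infer M₁ V₁ Γ₁ (τ ⊸ σ₁) b₁ →
    Infer M₂ V₂ Γ₂ ⌈ τ₂ ⌉ b₂ →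
    Unique (V₁ ++ V₂) →
    UnifyQ (τ₂ ≐ τ ∷ []) S b₃ →
    Infer (M₁ · M₂) (V₁ ++ V₂)
      (subᴱ S (Γ₁ ⊕ᴸ Γ₂)) (sub₂ S σ₁) (b₁ + b₂ + b₃ + 1)

  conv : ∀ {M V Γ Γ′ σ σ′ b} →
    Infer M V Γ σ b →
    Γ ≈ᴸᴱ Γ′ → σ ≈ σ′ →
    Infer M V Γ′ σ′ b

infix 3 TQ_↦_

TQ_↦_ : Λ → LEnv × LTy₂ × ℕ → Set
TQ M ↦ (Γ , σ , b) = ∃[ V ] Infer M V Γ σ b

{-# OPTIONS --safe #-}

-- A linear type is itself a multi-type without tight constants, so one may
-- take t⃗ᵢ = τ⃗ᵢ and s = σ: only the linear half of the judgment matters.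
-- Soundness of inference then goes by induction on the run, generalised over
-- all type substitutions (the unifier of an application is absorbed into
-- the substitution at which the hypotheses are used) and over all injective
-- renamings of term variables. At an application the renaming makes
-- the environment of the argument disjoint from that of the function, after
-- which the shared variables are contracted one at a time.

module Submission where

open import Defs
open import Data.Nat using (ℕ; suc; _+_; _≟_; _<_; _<?_; s≤s)
open import Data.Nat.Properties
  using (m≤n+m; +-cancelʳ-≡; <-≤-trans; <⇒≢)
open import Data.Maybe using (just; nothing; maybe′)
import Data.Maybe as Maybe
open import Data.Product using (∃-syntax; _×_; _,_; proj₁; proj₂)
import Data.Product as Product
open import Level using (0ℓ)
open import Data.Sum using (_⊎_; inj₁; inj₂)
open import Data.Vec using (Vec; []; _∷_; toList; zip; lookup)
import Data.Vec as Vec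
import Data.Fin as Fin
open import Data.Vec.Properties using (toList-map; lookup-map; lookup∘tabulate)
import Data.Vec.Properties as Vecₚ
import Data.List.NonEmpty.Properties as List⁺ₚ
open import Data.List using (List; []; _∷_; [_]; _++_; map; filter)
open import Data.List.Properties
  using (map-∘; map-++; map-id; map-cong; map-id-local; map-cong-local; ++-assoc;
         filter-all; filter-accept; filter-reject)
open import Data.List.NonEmpty using (List⁺; _∷_; _⁺++⁺_; fromVec)
import Data.List.NonEmpty as List⁺
open import Data.List.Extrema.Nat using (max; xs≤max)
open import Data.List.Membership.Propositional using (_∈_; _∉_)
open import Data.List.Membership.Propositional.Properties
  using (∈-map⁺; ∈-map⁻; ∈-++⁺ˡ; ∈-++⁺ʳ; ∈-filter⁺; ∈-filter⁻)
open import Data.List.Membership.DecPropositional _≟_ using (_∈?_)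
open import Data.List.Relation.Unary.All as All using (All; []; _∷_)
import Data.List.Relation.Unary.All.Properties as Allₚ
open import Data.List.Relation.Unary.Any using (here; there)
open import Data.List.Relation.Unary.AllPairs as AllPairs using ([]; _∷_)
import Data.List.Relation.Unary.AllPairs.Properties as AllPairsₚ
open import Data.List.Relation.Unary.Unique.Propositional using (Unique)
import Data.List.Relation.Unary.Unique.Propositional.Properties as Uniqueₚ
open import Data.List.Relation.Binary.Pointwise using ([]; _∷_)
open import Data.List.Relation.Binary.Permutation.Propositional
  using (_↭_; refl; prep; swap; trans; ↭-reflexive; ↭-sym; ↭⇒↭ₛ)
import Data.List.Relation.Binary.Permutation.Propositional.Properties as ↭ₚ
import Data.List.Relation.Binary.Permutation.Setoid.Properties as ↭ₛₚ
open import Function using (_∘_; id; Equivalence)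
open import Function.Definitions using (Injective)
open import Relation.Nullary using (¬_; Dec; yes; no; contradiction)
open import Relation.Nullary.Decidable using (¬?; _×-dec_)
open import Relation.Unary using (Pred; Decidable)
open import Relation.Binary.PropositionalEquality
  using (_≡_; _≢_; _≗_; refl; sym; cong; cong₂; subst; subst₂; setoid; module ≡-Reasoning)
import Relation.Binary.PropositionalEquality as ≡

private
  variable
    A B : Set
    n : ℕ
    x y : Var
    M₁ M₂ : Λ
    σ : LTy₂

-- Renaming of free variables

fv : Term n → List Var
fv (free x)  = [ x ]
fv (bound i) = []
fv (ƛ M)     = fv M
fv (M · N)   = fv M ++ fv N

rename : (Var → Var) → Term n → Term n
rename ρ (free x)  = free (ρ x)
rename ρ (bound i) = bound i
rename ρ (ƛ M)     = ƛ rename ρ M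
rename ρ (M · N)   = rename ρ M · rename ρ N

rename-cong : ∀ {ρ ρ′} (M : Term n) → All (λ x → ρ x ≡ ρ′ x) (fv M) →
              rename ρ M ≡ rename ρ′ M
rename-cong (free x)  (eq ∷ []) = cong free eq
rename-cong (bound i) eqs       = refl
rename-cong (ƛ M)     eqs       = cong ƛ_ (rename-cong M eqs)
rename-cong (M · N)   eqs       =
  cong₂ _·_ (rename-cong M (Allₚ.++⁻ˡ (fv M) eqs)) (rename-cong N (Allₚ.++⁻ʳ (fv M) eqs))

rename-id : (M : Term n) → rename id M ≡ M
rename-id (free x)  = refl
rename-id (bound i) = refl
rename-id (ƛ M)     = cong ƛ_ (rename-id M)
rename-id (M · N)   = cong₂ _·_ (rename-id M) (rename-id N)

rename-∘ : ∀ ρ′ ρ (M : Term n) → rename ρ′ (rename ρ M) ≡ rename (ρ′ ∘ ρ) M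
rename-∘ ρ′ ρ (free x)  = refl
rename-∘ ρ′ ρ (bound i) = refl
rename-∘ ρ′ ρ (ƛ M)     = cong ƛ_ (rename-∘ ρ′ ρ M)
rename-∘ ρ′ ρ (M · N)   = cong₂ _·_ (rename-∘ ρ′ ρ M) (rename-∘ ρ′ ρ N)

-- Injectivity excludes capture: `ρ y ≡ ρ x` forces `y ≡ x`, so the same occurrences become bound on
-- both sides.
rename-close : ∀ {ρ} → Injective _≡_ _≡_ ρ → ∀ x (M : Term n) →
               rename ρ (close x M) ≡ close (ρ x) (rename ρ M)
rename-close {ρ = ρ} inj x (free y) with y ≟ x | ρ y ≟ ρ x
... | yes _    | yes _   = refl
... | yes refl | no ≢    = contradiction refl ≢
... | no ≢     | yes eq  = contradiction (inj eq) ≢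
... | no _     | no _    = refl
rename-close inj x (bound i) = refl
rename-close inj x (ƛ M)     = cong ƛ_ (rename-close inj x M)
rename-close inj x (M · N)   = cong₂ _·_ (rename-close inj x M) (rename-close inj x N)

_[_↦_] : (Var → Var) → Var → Var → Var → Var
(ρ [ x ↦ y ]) z with z ≟ x
... | yes _ = y
... | no _  = ρ z

↦-other : ∀ ρ {x z} y → z ≢ x → (ρ [ x ↦ y ]) z ≡ ρ z
↦-other ρ {x} {z} y z≢x with z ≟ x
... | yes eq = contradiction eq z≢x
... | no _   = refl

-- Reduces questions about variable substitution to pointwise comparison of renamings on `fv`, by
-- way of `rename-∘` and `rename-cong`.
[/]-rename : ∀ y x (M : Term n) → M [ y / x ] ≡ rename (id [ x ↦ y ]) M
[/]-rename y x (free z) with z ≟ x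
... | yes _ = refl
... | no _  = refl
[/]-rename y x (bound i) = refl
[/]-rename y x (ƛ M)     = cong ƛ_ ([/]-rename y x M)
[/]-rename y x (M · N)   = cong₂ _·_ ([/]-rename y x M) ([/]-rename y x N)

[/]-self : ∀ x (M : Term n) → M [ x / x ] ≡ M
[/]-self x M = begin
  M [ x / x ]               ≡⟨ [/]-rename x x M ⟩
  rename (id [ x ↦ x ]) M   ≡⟨ rename-cong M (All.universal id[x↦x] (fv M)) ⟩
  rename id M               ≡⟨ rename-id M ⟩
  M                         ∎
  where
  open ≡-Reasoning
  id[x↦x] : ∀ z → (id [ x ↦ x ]) z ≡ z
  id[x↦x] z with z ≟ x
  ... | yes refl = refl
  ... | no _     = refl

[/]-∉ : ∀ y {x} (M : Term n) → All (_≢ x) (fv M) → M [ y / x ] ≡ M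
[/]-∉ y {x} M x∉M = begin
  M [ y / x ]               ≡⟨ [/]-rename y x M ⟩
  rename (id [ x ↦ y ]) M   ≡⟨ rename-cong M (All.map (↦-other id y) x∉M) ⟩
  rename id M               ≡⟨ rename-id M ⟩
  M                         ∎
  where open ≡-Reasoning

-- Since no other free variable of `M` is sent to `ρ x`, substituting `x` for `ρ x` undoes `ρ` at
-- the single point `x`. This is how a renaming is taken back one variable at a time.
rename-[/] : ∀ ρ x (M : Term n) → All (λ z → ρ z ≡ ρ x → z ≡ x) (fv M) →
             rename ρ M [ x / ρ x ] ≡ rename (ρ [ x ↦ x ]) M
rename-[/] ρ x M inj = begin
  rename ρ M [ x / ρ x ]                 ≡⟨ [/]-rename x (ρ x) (rename ρ M) ⟩
  rename (id [ ρ x ↦ x ]) (rename ρ M)   ≡⟨ rename-∘ _ ρ M ⟩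
  rename ((id [ ρ x ↦ x ]) ∘ ρ) M        ≡⟨ rename-cong M (All.map agree inj) ⟩
  rename (ρ [ x ↦ x ]) M                 ∎
  where
  open ≡-Reasoning
  agree : ∀ {z} → (ρ z ≡ ρ x → z ≡ x) → (id [ ρ x ↦ x ]) (ρ z) ≡ (ρ [ x ↦ x ]) z
  agree {z} inj with z ≟ x | ρ z ≟ ρ x
  ... | yes _    | yes _  = refl
  ... | yes refl | no ≢   = contradiction refl ≢
  ... | no ≢     | yes eq = contradiction (inj eq) ≢
  ... | no _     | no _   = refl

-- Declarations

Consistent-resp-↭ : {Γ Δ : Decls A} → Γ ↭ Δ → Consistent Γ → Consistent Δ
Consistent-resp-↭ p = ↭ₛₚ.Unique-resp-↭ (setoid Var) (↭⇒↭ₛ (↭ₚ.map⁺ proj₁ p))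

consistent-filter : {P : Pred (Var × A) 0ℓ} (P? : Decidable P) {Γ : Decls A} →
                    Consistent Γ → Consistent (filter P? Γ)
consistent-filter P? = AllPairsₚ.map⁺ ∘ AllPairsₚ.filter⁺ P? ∘ AllPairsₚ.map⁻

dom-map : (ρ : Var → Var) (h : A → B) (Γ : Decls A) →
          dom (map (Product.map ρ h) Γ) ≡ map ρ (dom Γ)
dom-map ρ h Γ = ≡.trans (sym (map-∘ Γ)) (map-∘ Γ)

filter-filter : {P Q R : Pred A 0ℓ} {P? : Decidable P} {Q? : Decidable Q} {R? : Decidable R} →
                (∀ {x} → P x → Q x → R x) → (∀ {x} → R x → P x) → (∀ {x} → R x → Q x) →
                filter Q? ∘ filter P? ≗ filter R?
filter-filter pq⇒r r⇒p r⇒q [] = refl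
filter-filter {P? = P?} {Q?} {R?} pq⇒r r⇒p r⇒q (x ∷ xs)
  with ih ← filter-filter {P? = P?} {Q?} {R?} pq⇒r r⇒p r⇒q xs | P? x | R? x
... | no ¬p | yes r = contradiction (r⇒p r) ¬p
... | no _  | no _  = ih
... | yes p | r? with Q? x | r?
...   | yes _ | yes _ = cong (x ∷_) ih
...   | yes q | no ¬r = contradiction (pq⇒r p q) ¬r
...   | no ¬q | yes r = contradiction (r⇒q r) ¬q
...   | no _  | no _  = ih

module _ {A : Set} where

  ∖-∉ : {Γ : Decls A} → x ∉ dom Γ → Γ ∖ x ≡ Γ
  ∖-∉ x∉Γ = filter-all _ (All.tabulate λ { d∈Γ refl → x∉Γ (∈-map⁺ proj₁ d∈Γ) })

  ∈-dom-∖⁻ : (Γ : Decls A) → y ∈ dom (Γ ∖ x) → y ∈ dom Γ × y ≢ x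
  ∈-dom-∖⁻ Γ y∈ with d , d∈ , refl ← ∈-map⁻ proj₁ y∈ =
    Product.map₁ (∈-map⁺ proj₁) (∈-filter⁻ _ {xs = Γ} d∈)

  ∈-dom-∖⁺ : (Γ : Decls A) → y ∈ dom Γ → y ≢ x → y ∈ dom (Γ ∖ x)
  ∈-dom-∖⁺ Γ y∈ y≢x with d , d∈ , refl ← ∈-map⁻ proj₁ y∈ = ∈-map⁺ proj₁ (∈-filter⁺ _ d∈ y≢x)

  ∖-≡ : ∀ x {a} (Γ : Decls A) → ((x , a) ∷ Γ) ∖ x ≡ Γ ∖ x
  ∖-≡ x Γ = filter-reject (λ d → ¬? (proj₁ d ≟ x)) (λ ≢ → ≢ refl)

  ∖-≢ : ∀ {a} → y ≢ x → (Γ : Decls A) → ((y , a) ∷ Γ) ∖ x ≡ (y , a) ∷ Γ ∖ x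
  ∖-≢ {x = x} y≢x Γ = filter-accept (λ d → ¬? (proj₁ d ≟ x)) y≢x

  -- Consistency leaves no second declaration of `x`, so the removal loses only the one displayed.
  -- It brings a chosen variable to the front, to be bound or contracted.
  ↭-∖ : ∀ {a} {Γ : Decls A} → Consistent Γ → (x , a) ∈ Γ → Γ ↭ (x , a) ∷ Γ ∖ x
  ↭-∖ {x} {Γ = _ ∷ Γ} (x∉Γ ∷ _) (here refl) =
    prep _ (↭-reflexive (sym (≡.trans (∖-≡ x Γ) (∖-∉ (Allₚ.All¬⇒¬Any x∉Γ)))))
  ↭-∖ {x} {Γ = (y , _) ∷ Γ} (y∉Γ ∷ Γ-cons) (there x∈Γ) =
    trans (prep _ (↭-∖ Γ-cons x∈Γ)) (trans (swap _ _ refl) (prep _ (↭-reflexive (sym (∖-≢ y≢x Γ)))))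
    where
    y≢x : y ≢ x
    y≢x refl = Allₚ.All¬⇒¬Any y∉Γ (∈-map⁺ proj₁ x∈Γ)

  assoc-∉ : {Γ : Decls A} → x ∉ dom Γ → assoc x Γ ≡ nothing
  assoc-∉ {Γ = []} _ = refl
  assoc-∉ {x} {Γ = (y , a) ∷ Γ} x∉ with x ≟ y
  ... | yes refl = contradiction (here refl) x∉
  ... | no _     = assoc-∉ (x∉ ∘ there)

  assoc-∈ : {Γ : Decls A} → x ∈ dom Γ → ∃[ a ] assoc x Γ ≡ just a × (x , a) ∈ Γ
  assoc-∈ {x} {Γ = (y , a) ∷ Γ} x∈ with x ≟ y | x∈
  ... | yes refl | _          = a , refl , here refl
  ... | no x≢y   | here x≡y   = contradiction x≡y x≢y
  ... | no _     | there x∈Γ  with a , eq , ∈Γ ← assoc-∈ x∈Γ = a , eq , there ∈Γ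

  assoc-unique : ∀ {a} {Γ : Decls A} → Consistent Γ → (x , a) ∈ Γ → assoc x Γ ≡ just a
  assoc-unique {x} {Γ = (y , _) ∷ Γ} (y∉Γ ∷ Γ-cons) ∈Γ with x ≟ y | ∈Γ
  ... | yes refl | here refl = refl
  ... | yes refl | there ∈Γ  = contradiction (∈-map⁺ proj₁ ∈Γ) (Allₚ.All¬⇒¬Any y∉Γ)
  ... | no x≢y   | here refl = contradiction refl x≢y
  ... | no _     | there ∈Γ  = assoc-unique Γ-cons ∈Γ

  assoc-≢ : ∀ {a} → y ≢ x → (Γ : Decls A) → assoc y ((x , a) ∷ Γ) ≡ assoc y Γ
  assoc-≢ {y} {x} y≢x Γ with y ≟ x
  ... | yes y≡x = contradiction y≡x y≢x
  ... | no _    = refl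

  assoc-cong : ∀ {y z} a (Γ Δ : Decls A) → assoc y Γ ≡ assoc y Δ →
               assoc y ((z , a) ∷ Γ) ≡ assoc y ((z , a) ∷ Δ)
  assoc-cong {y} {z} a Γ Δ eq with y ≟ z
  ... | yes _ = refl
  ... | no _  = eq

  assoc-∖ : y ≢ x → (Γ : Decls A) → assoc y (Γ ∖ x) ≡ assoc y Γ
  assoc-∖ y≢x [] = refl
  assoc-∖ {y} {x} y≢x ((z , a) ∷ Γ) = by-cases (z ≟ x)
    where
    by-cases : Dec (z ≡ x) → assoc y (((z , a) ∷ Γ) ∖ x) ≡ assoc y ((z , a) ∷ Γ)
    by-cases (yes refl) = begin
      assoc y (((x , a) ∷ Γ) ∖ x)  ≡⟨ cong (assoc y) (∖-≡ x Γ) ⟩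
      assoc y (Γ ∖ x)              ≡⟨ assoc-∖ y≢x Γ ⟩
      assoc y Γ                    ≡⟨ assoc-≢ y≢x Γ ⟨
      assoc y ((x , a) ∷ Γ)        ∎
      where open ≡-Reasoning
    by-cases (no z≢x) = ≡.trans (cong (assoc y) (∖-≢ z≢x Γ)) (assoc-cong a (Γ ∖ x) Γ (assoc-∖ y≢x Γ))

  outside : List Var → Decls A → Decls A
  outside xs = filter (λ d → ¬? (proj₁ d ∈? xs))

  outside-∷ : ∀ x xs (Γ : Decls A) → outside (x ∷ xs) Γ ≡ outside xs (Γ ∖ x)
  outside-∷ x xs Γ = sym (filter-filter
    (λ ≢ ∉ → λ { (here ≡) → ≢ ≡ ; (there ∈) → ∉ ∈ }) (_∘ here) (_∘ there) Γ)

  module _ (_∩_ : A → A → A) where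

    -- `merge` is not recursive in its first environment; this equation makes induction on it
    -- possible. Because `x` is absent from `Γ`, deleting it from `Δ` does not affect what the
    -- declarations of `Γ` look up.
    merge-∷ : ∀ {x a} (Γ Δ : Decls A) → x ∉ dom Γ →
              merge _∩_ ((x , a) ∷ Γ) Δ ≡
              (x , maybe′ (a ∩_) a (assoc x Δ)) ∷ merge _∩_ Γ (Δ ∖ x)
    merge-∷ {x} Γ Δ x∉Γ = cong (_ ∷_) (cong₂ _++_
      (map-cong-local (All.tabulate λ { {y , c} d∈Γ →
        cong (λ o → y , maybe′ (c ∩_) c o) (sym (assoc-∖ (λ { refl → x∉Γ (∈-map⁺ proj₁ d∈Γ) }) Δ)) }))
      (outside-∷ x (dom Γ) Δ))

    merge-[] : (Δ : Decls A) → merge _∩_ [] Δ ≡ Δ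
    merge-[] Δ = filter-all _ (All.universal (λ _ ()) Δ)

    consistent-merge : {Γ Δ : Decls A} → Consistent Γ → Consistent Δ → Consistent (merge _∩_ Γ Δ)
    consistent-merge {Γ} {Δ} cΓ cΔ
      rewrite map-++ proj₁ (map (λ (x , a) → x , maybe′ (a ∩_) a (assoc x Δ)) Γ) (outside (dom Γ) Δ)
            | sym (map-∘ {g = proj₁} {f = λ (x , a) → x , maybe′ (a ∩_) a (assoc x Δ)} Γ)
      = Uniqueₚ.++⁺ cΓ (consistent-filter _ cΔ) disjoint
      where
      disjoint : ∀ {v} → ¬ (v ∈ dom Γ × v ∈ dom (outside (dom Γ) Δ))
      disjoint (v∈Γ , v∈Δ) with d , d∈ , refl ← ∈-map⁻ proj₁ v∈Δ =
        proj₂ (∈-filter⁻ (λ d → ¬? (proj₁ d ∈? dom Γ)) {xs = Δ} d∈) v∈Γ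

module _ {ρ : Var → Var} (inj : Injective _≡_ _≡_ ρ) (h : A → B) where

  private
    F : Var × A → Var × B
    F = Product.map ρ h

  assoc-map : ∀ x Γ → assoc (ρ x) (map F Γ) ≡ Maybe.map h (assoc x Γ)
  assoc-map x [] = refl
  assoc-map x ((y , a) ∷ Γ) with x ≟ y | ρ x ≟ ρ y
  ... | yes _    | yes _  = refl
  ... | yes refl | no ≢   = contradiction refl ≢
  ... | no ≢     | yes eq = contradiction (inj eq) ≢
  ... | no _     | no _   = assoc-map x Γ

  outside-map : ∀ xs Δ → map F (outside xs Δ) ≡ outside (map ρ xs) (map F Δ)
  outside-map xs [] = refl
  outside-map xs ((y , a) ∷ Δ) with y ∈? xs | ρ y ∈? map ρ xs
  ... | yes _ | yes _ = outside-map xs Δ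
  ... | yes ∈ | no ∉  = contradiction (∈-map⁺ ρ ∈) ∉
  ... | no ∉  | yes ∈ with z , z∈ , eq ← ∈-map⁻ ρ ∈ =
    contradiction (subst (_∈ xs) (sym (inj eq)) z∈) ∉
  ... | no _  | no _  = cong (_ ∷_) (outside-map xs Δ)

  -- An injective `ρ` preserves which names are equal, so both the lookups and the membership tests
  -- in `merge` have the same outcome after renaming; `hom` handles the names declared twice.
  map-merge : ∀ {_∩_ _∩′_} → (∀ a a′ → h (a ∩ a′) ≡ h a ∩′ h a′) → ∀ Γ Δ →
              map F (merge _∩_ Γ Δ) ≡ merge _∩′_ (map F Γ) (map F Δ)
  map-merge {_∩_} {_∩′_} hom Γ Δ = begin
    map F (map f Γ ++ outside (dom Γ) Δ)
      ≡⟨ map-++ F (map f Γ) _ ⟩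
    map F (map f Γ) ++ map F (outside (dom Γ) Δ)
      ≡⟨ cong₂ _++_ (≡.trans (sym (map-∘ Γ)) (≡.trans (map-cong F∘f≗f′∘F Γ) (map-∘ Γ)))
                    (outside-map (dom Γ) Δ) ⟩
    map f′ (map F Γ) ++ outside (map ρ (dom Γ)) (map F Δ)
      ≡⟨ cong (λ xs → map f′ (map F Γ) ++ outside xs (map F Δ)) (sym (dom-map ρ h Γ)) ⟩
    merge _∩′_ (map F Γ) (map F Δ) ∎
    where
    open ≡-Reasoning
    f : Var × A → Var × A
    f (x , a) = x , maybe′ (a ∩_) a (assoc x Δ)
    f′ : Var × B → Var × B
    f′ (x , a) = x , maybe′ (a ∩′_) a (assoc x (map F Δ))
    F∘f≗f′∘F : F ∘ f ≗ f′ ∘ F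
    F∘f≗f′∘F (x , a) rewrite assoc-map x Δ with assoc x Δ
    ... | just c  = cong (ρ x ,_) (hom a c)
    ... | nothing = refl

  map-∑ : ∀ {_∩_ _∩′_} → (∀ a a′ → h (a ∩ a′) ≡ h a ∩′ h a′) → (Γs : Vec (Decls A) n) →
          map F (Vec.foldr′ (merge _∩_) [] Γs) ≡
          Vec.foldr′ (merge _∩′_) [] (Vec.map (map F) Γs)
  map-∑ hom []       = refl
  map-∑ {_∩_ = _∩_} {_∩′_} hom (Γ ∷ Γs) =
    ≡.trans (map-merge {_∩′_ = _∩′_} hom Γ (Vec.foldr′ (merge _∩_) [] Γs))
            (cong (merge _∩′_ (map F Γ)) (map-∑ {_∩_ = _∩_} hom Γs))

-- Instances of linear types

-- Total functions instead of finite lists, so that following a substitution by an instance is plain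
-- composition, `_⊙_`.
Instance : Set
Instance = TVar → LTy

inst : Instance → LTy → LTy
inst f (var α)  = f α
inst f (τ ⊸ τ′) = inst f τ ⊸ inst f τ′

inst₂ : Instance → LTy₂ → LTy₂
inst₂ f (var α)  = ⌈ f α ⌉
inst₂ f (τ ⊸ σ)  = inst f τ ⊸ inst₂ f σ
inst₂ f (τs ⇒ σ) = Vec.map (inst f) τs ⇒ inst₂ f σ

instᴱ : Instance → (Var → Var) → LEnv → LEnv
instᴱ f ρ = map (Product.map ρ (List⁺.map (inst f)))

_⊙_ : Instance → Subst → Instance
(f ⊙ S) α = inst f (subᵛ S α)

inst-sub : ∀ f S τ → inst f (sub S τ) ≡ inst (f ⊙ S) τ
inst-sub f S (var α)  = refl
inst-sub f S (τ ⊸ τ′) = cong₂ _⊸_ (inst-sub f S τ) (inst-sub f S τ′)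

inst-cong : ∀ {f g} τ → (∀ α → α occursIn τ → f α ≡ g α) → inst f τ ≡ inst g τ
inst-cong (var α)  eq = eq α refl
inst-cong (τ ⊸ τ′) eq =
  cong₂ _⊸_ (inst-cong τ (λ α → eq α ∘ inj₁)) (inst-cong τ′ (λ α → eq α ∘ inj₂))

inst-var : ∀ τ → inst var τ ≡ τ
inst-var (var α)  = refl
inst-var (τ ⊸ τ′) = cong₂ _⊸_ (inst-var τ) (inst-var τ′)

inst₂-⌈⌉ : ∀ f τ → inst₂ f ⌈ τ ⌉ ≡ ⌈ inst f τ ⌉
inst₂-⌈⌉ f (var α)  = refl
inst₂-⌈⌉ f (τ ⊸ τ′) = cong (inst f τ ⊸_) (inst₂-⌈⌉ f τ′)

inst₂-sub : ∀ f S σ → inst₂ f (sub₂ S σ) ≡ inst₂ (f ⊙ S) σ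
inst₂-sub f S (var α)  = inst₂-⌈⌉ f (subᵛ S α)
inst₂-sub f S (τ ⊸ σ)  = cong₂ _⊸_ (inst-sub f S τ) (inst₂-sub f S σ)
inst₂-sub f S (τs ⇒ σ) = cong₂ _⇒_
  (≡.trans (sym (Vecₚ.map-∘ (inst f) (sub S) τs)) (Vecₚ.map-cong (inst-sub f S) τs))
  (inst₂-sub f S σ)

inst₂-var : ∀ σ → inst₂ var σ ≡ σ
inst₂-var (var α)  = refl
inst₂-var (τ ⊸ σ)  = cong₂ _⊸_ (inst-var τ) (inst₂-var σ)
inst₂-var (τs ⇒ σ) =
  cong₂ _⇒_ (≡.trans (Vecₚ.map-cong inst-var τs) (Vecₚ.map-id τs)) (inst₂-var σ)

instᴱ-sub : ∀ f ρ S Γ → instᴱ f ρ (subᴱ S Γ) ≡ instᴱ (f ⊙ S) ρ Γ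
instᴱ-sub f ρ S Γ = ≡.trans (sym (map-∘ Γ)) (map-cong (λ (x , τ⃗) → cong (ρ x ,_) (⁺-sub τ⃗)) Γ)
  where
  ⁺-sub : ∀ τ⃗ → List⁺.map (inst f) (List⁺.map (sub S) τ⃗) ≡ List⁺.map (inst (f ⊙ S)) τ⃗
  ⁺-sub τ⃗ = ≡.trans (sym (List⁺ₚ.map-∘ τ⃗)) (List⁺ₚ.map-cong (inst-sub f S) τ⃗)

instᴱ-var : ∀ Γ → instᴱ var id Γ ≡ Γ
instᴱ-var Γ =
  map-id-local (All.universal (λ (x , τ ∷ τs) →
    cong (x ,_) (cong₂ _∷_ (inst-var τ) (map-id-local (All.universal inst-var τs)))) Γ)

map-⁺++⁺ : (h : A → B) (as as′ : List⁺ A) →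
           List⁺.map h (as ⁺++⁺ as′) ≡ List⁺.map h as ⁺++⁺ List⁺.map h as′
map-⁺++⁺ h (a ∷ as) (a′ ∷ as′) = cong (h a ∷_) (map-++ h as (a′ ∷ as′))

map-fromVec : (h : A → B) (as : Vec A (suc n)) →
              List⁺.map h (fromVec as) ≡ fromVec (Vec.map h as)
map-fromVec h (a ∷ as) = cong (h a ∷_) (sym (toList-map h as))

inst₂-≈ : ∀ f {σ σ′} → σ ≈ σ′ → inst₂ f σ ≈ inst₂ f σ′
inst₂-≈ f {var α} var           = ≈-refl ⌈ f α ⌉
  where
  ≈-refl : ∀ σ → σ ≈ σ
  ≈-refl (var α)  = var
  ≈-refl (τ ⊸ σ)  = τ ⊸ ≈-refl σ
  ≈-refl (τs ⇒ σ) = refl ⇒ ≈-refl σ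
inst₂-≈ f (τ ⊸ σ≈)              = inst f τ ⊸ inst₂-≈ f σ≈
inst₂-≈ f (_⇒_ {τs = τs} {τs′} p σ≈) =
  subst₂ _≈ˢ_ (map-fromVec (inst f) τs) (map-fromVec (inst f) τs′) (↭ₚ.map⁺ (inst f) p)
  ⇒ inst₂-≈ f σ≈

instᴱ-≈ : ∀ f ρ {Γ Γ′} → Γ ≈ᴸᴱ Γ′ → instᴱ f ρ Γ ≈ᴸᴱ instᴱ f ρ Γ′
instᴱ-≈ f ρ []               = []
instᴱ-≈ f ρ ((refl , p) ∷ Γ≈) = (refl , ↭ₚ.map⁺ (inst f) p) ∷ instᴱ-≈ f ρ Γ≈

instᴱ-⊕ : ∀ f {ρ} → Injective _≡_ _≡_ ρ → ∀ Γ Δ →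
          instᴱ f ρ (Γ ⊕ᴸ Δ) ≡ instᴱ f ρ Γ ⊕ᴸ instᴱ f ρ Δ
instᴱ-⊕ f inj = map-merge inj _ (map-⁺++⁺ (inst f))

instᴱ-∑ : ∀ f {ρ} → Injective _≡_ _≡_ ρ → (Γs : Vec LEnv n) →
          instᴱ f ρ (∑ᴸ Γs) ≡ ∑ᴸ (Vec.map (instᴱ f ρ) Γs)
instᴱ-∑ f inj = map-∑ inj _ {_∩_ = _⁺++⁺_} (map-⁺++⁺ (inst f))

-- Unification

Unifies : Instance → Problem → Set
Unifies f = All (λ (l ≐ r) → inst f l ≡ inst f r)

Unifies-⊇ : ∀ {f P Q} → (∀ {e} → e ∈ P → e ∈ Q) → Unifies f Q → Unifies f P
Unifies-⊇ P⊆Q us = All.tabulate (All.lookup us ∘ P⊆Q)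

contract-unifies : ∀ {f e P k Q} → Contract e P k (just Q) → Unifies f Q → Unifies f (e ∷ P)
contract-unifies delete us = refl ∷ us
contract-unifies decompose (u ∷ u′ ∷ us) = cong₂ _⊸_ u u′ ∷ us
contract-unifies orient (u ∷ us) = sym u ∷ us
-- By `u`, `f` already sends `α` to the instance of `τ`, so replacing `α` by `τ` beforehand changes
-- no instance under `f`; `absorb` carries each substituted equation back to `P`.
contract-unifies {f} (eliminate {α} {τ} _ _) (u ∷ us) =
  u ∷ All.map (λ {(l ≐ r)} u′ → ≡.trans (sym (absorb l)) (≡.trans u′ (absorb r))) (Allₚ.map⁻ us)
  where
  absorbᵛ : ∀ β → (f ⊙ [ α , τ ]) β ≡ f β
  absorbᵛ β with β ≟ α
  ... | yes refl = sym u
  ... | no _     = refl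
  absorb : ∀ τ′ → inst f (sub [ α , τ ] τ′) ≡ inst f τ′
  absorb τ′ = ≡.trans (inst-sub f [ α , τ ] τ′) (inst-cong τ′ (λ β _ → absorbᵛ β))

steps-unify : ∀ {f P Q b} → P ⟶*[ b ] Q → Unifies f Q → Unifies f P
steps-unify done us = us
steps-unify (step (_ , _ , P∼ , _ , c) Q⟶*) us =
  Unifies-⊇ (Equivalence.to P∼) (contract-unifies c (steps-unify Q⟶* us))

solved-unifies : ∀ {S} → Solved S → ∀ f → Unifies (f ⊙ S) (equations S)
solved-unifies {S} (unique , acyclic) f = Allₚ.map⁺ (All.tabulate solves)
  where
  assoc-α : ∀ {α τ} → (α , τ) ∈ S → subᵛ S α ≡ τ
  assoc-α ∈S rewrite assoc-unique unique ∈S = refl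
  fixed : ∀ {τ} → τ ∈ map proj₂ S → ∀ β → β occursIn τ → subᵛ S β ≡ var β
  fixed τ∈ β β∈τ rewrite assoc-∉ {Γ = S} (λ β∈S → acyclic β∈S τ∈ β∈τ) = refl
  solves : ∀ {e} → e ∈ S → inst (f ⊙ S) (var (proj₁ e)) ≡ inst (f ⊙ S) (proj₂ e)
  solves {α , τ} ∈S = ≡.trans (cong (inst f) (assoc-α ∈S))
    (inst-cong τ (λ β β∈τ → cong (inst f) (sym (fixed (∈-map⁺ proj₂ ∈S) β β∈τ))))

-- Unifiers of the solved form are carried backwards along the run to the initial problem.
unifyQ-unifies : ∀ {P S b} → UnifyQ P S b → ∀ f → Unifies (f ⊙ S) P
unifyQ-unifies (Q , P⟶*Q , Q∼ , solved) f =
  steps-unify P⟶*Q (Unifies-⊇ (Equivalence.to Q∼) (solved-unifies solved f))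

unifies-zipWith : ∀ {f} (τs τs′ : Vec LTy n) → Unifies f (toList (Vec.zipWith _≐_ τs τs′)) →
                  Vec.map (inst f) τs ≡ Vec.map (inst f) τs′
unifies-zipWith []       []         []       = refl
unifies-zipWith (τ ∷ τs) (τ′ ∷ τs′) (u ∷ us) = cong₂ _∷_ u (unifies-zipWith τs τs′ us)

-- Linear types as multi-types

mty : LTy → MTy
mty (var α)  = var α
mty (τ ⊸ τ′) = mty τ ⊸ mty τ′

-- The intersection has the form `fromVec ts` because `⇒-intro` and `⇒-elim` expect it so.
mty₂ : LTy₂ → MTy₂
mty₂ (var α)  = var α
mty₂ (τ ⊸ σ)  = mty τ ⊸ mty₂ σ
mty₂ (τs ⇒ σ) = fromVec (Vec.map mty τs) ⇒ mty₂ σ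

mty₂-⌈⌉ : ∀ τ → mty₂ ⌈ τ ⌉ ≡ ⌈ mty τ ⌉ᵐ
mty₂-⌈⌉ (var α)  = refl
mty₂-⌈⌉ (τ ⊸ τ′) = cong (mty τ ⊸_) (mty₂-⌈⌉ τ′)

mty₂-≈ : ∀ {σ σ′} → σ ≈ σ′ → mty₂ σ ≈ᵐ mty₂ σ′
mty₂-≈ var = var
mty₂-≈ (τ ⊸ σ≈) = mty τ ⊸ mty₂-≈ σ≈
mty₂-≈ (_⇒_ {τs = τs} {τs′} p σ≈) =
  subst₂ _≈ˢ_ (map-fromVec mty τs) (map-fromVec mty τs′) (↭ₚ.map⁺ mty p) ⇒ mty₂-≈ σ≈

double : LSeq → LSeq × MSeq
double τ⃗ = τ⃗ , List⁺.map mty τ⃗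

doubleᴱ : LEnv → Env
doubleᴱ = map (Product.map id double)

double-⁺++⁺ : ∀ τ⃗ τ⃗′ → double (τ⃗ ⁺++⁺ τ⃗′) ≡ (τ⃗ ⁺++⁺ τ⃗′ , List⁺.map mty τ⃗ ⁺++⁺ List⁺.map mty τ⃗′)
double-⁺++⁺ τ⃗ τ⃗′ = cong (τ⃗ ⁺++⁺ τ⃗′ ,_) (map-⁺++⁺ mty τ⃗ τ⃗′)

doubleᴱ-∑ : (Γs : Vec LEnv n) → doubleᴱ (∑ᴸ Γs) ≡ ∑ (Vec.map doubleᴱ Γs)
doubleᴱ-∑ = map-∑ id double {_∩_ = _⁺++⁺_} double-⁺++⁺

doubleᴱ-≈ : ∀ {Γ Γ′} → Γ ≈ᴸᴱ Γ′ → doubleᴱ Γ ≈ᴱ doubleᴱ Γ′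
doubleᴱ-≈ []               = []
doubleᴱ-≈ ((refl , p) ∷ Γ≈) = (refl , p , ↭ₚ.map⁺ mty p) ∷ doubleᴱ-≈ Γ≈

consistent-doubleᴱ : ∀ {Γ} → Consistent Γ → Consistent (doubleᴱ Γ)
consistent-doubleᴱ {Γ} = subst Unique (sym (≡.trans (dom-map id double Γ) (map-id (dom Γ))))

-- The linear half of the judgment

infix 3 _⊢_∶_

_⊢_∶_ : LEnv → Λ → LTy₂ → Set
Γ ⊢ M ∶ σ = ∃[ b ] doubleᴱ Γ ⊢[ b ] M ∶ (σ , mty₂ σ)

axiom′ : ∀ τ → [ x , List⁺.[ τ ] ] ⊢ free x ∶ ⌈ τ ⌉
axiom′ {x} τ = 0 ,
  subst (λ s → doubleᴱ [ x , List⁺.[ τ ] ] ⊢[ 0 ] free x ∶ (⌈ τ ⌉ , s))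
    (sym (mty₂-⌈⌉ τ)) axiom

conv′ : ∀ {Γ Γ′ M σ σ′} → Γ ⊢ M ∶ σ → Γ ≈ᴸᴱ Γ′ → σ ≈ σ′ → Γ′ ⊢ M ∶ σ′
conv′ (_ , D) Γ≈ σ≈ = _ , conv D (doubleᴱ-≈ Γ≈) σ≈ (mty₂-≈ σ≈)

-- The prefix `Γ₀` makes the induction on the permutation go through: declarations that `prep` and
-- `swap` leave behind are moved into it.
exchanges : ∀ Γ₀ {Γ Γ′ b M T} → Γ ↭ Γ′ → Γ₀ ++ Γ ⊢[ b ] M ∶ T → Γ₀ ++ Γ′ ⊢[ b ] M ∶ T
exchanges Γ₀ refl         D = D
exchanges Γ₀ (trans p p′) D = exchanges Γ₀ p′ (exchanges Γ₀ p D)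
exchanges Γ₀ {b = b} {M} {T} (prep {xs} {ys} d p) D =
  subst (_⊢[ b ] M ∶ T) (++-assoc Γ₀ [ d ] ys)
    (exchanges (Γ₀ ++ [ d ]) p
      (subst (_⊢[ b ] M ∶ T) (sym (++-assoc Γ₀ [ d ] xs)) D))
exchanges Γ₀ {b = b} {M} {T} (swap {xs} {ys} d d′ p) D =
  subst (_⊢[ b ] M ∶ T) (++-assoc Γ₀ (d′ ∷ [ d ]) ys)
    (exchanges (Γ₀ ++ d′ ∷ [ d ]) p
      (subst (_⊢[ b ] M ∶ T) (sym (++-assoc Γ₀ (d′ ∷ [ d ]) xs)) (exchange Γ₀ D)))

exchange′ : ∀ {Γ Γ′ M σ} → Γ ↭ Γ′ → Γ ⊢ M ∶ σ → Γ′ ⊢ M ∶ σ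
exchange′ p (b , D) = b , exchanges [] (↭ₚ.map⁺ (Product.map id double) p) D

-- The case of `contraction` in which the first variable keeps its name; the substitution `x / x`
-- that arises is removed by `[/]-self`.
contraction′ : ∀ {Γ x y τ⃗ τ⃗′ M σ} → (x , τ⃗) ∷ (y , τ⃗′) ∷ Γ ⊢ M ∶ σ →
               Consistent ((x , τ⃗ ⁺++⁺ τ⃗′) ∷ Γ) → (x , τ⃗ ⁺++⁺ τ⃗′) ∷ Γ ⊢ M [ x / y ] ∶ σ
contraction′ {Γ} {x} {y} {τ⃗} {τ⃗′} {M} {σ} (b , D) c = b ,
  subst₂ (λ d N → (x , d) ∷ doubleᴱ Γ ⊢[ b ] N ∶ (σ , mty₂ σ))
    (sym (double-⁺++⁺ τ⃗ τ⃗′)) (cong (_[ x / y ]) ([/]-self x M))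
    (contraction [] D (consistent-doubleᴱ {(x , τ⃗ ⁺++⁺ τ⃗′) ∷ Γ} c))

module _ {Γ : LEnv} {x : Var} {M : Λ} {σ : LTy₂} where

  ⊸-intro′ : ∀ {τ} → (x , List⁺.[ τ ]) ∷ Γ ⊢ M ∶ σ → Γ ⊢ lam x M ∶ τ ⊸ σ
  -- The bound variable is moved from the front to the last position, where the rule discharges it.
  ⊸-intro′ (b , D) = _ , ⊸-intro (exchanges [] (↭ₚ.∷↭∷ʳ _ (doubleᴱ Γ)) D)

  ⇒-intro′ : {τs : Vec LTy (suc (suc n))} → (x , fromVec τs) ∷ Γ ⊢ M ∶ σ →
             Γ ⊢ lam x M ∶ τs ⇒ σ
  ⇒-intro′ {τs = τs} (b , D) = _ , ⇒-intro
    (subst (λ t⃗ → doubleᴱ Γ ++ [ x , fromVec τs , t⃗ ] ⊢[ b ] M ∶ (σ , mty₂ σ)) (map-fromVec mty τs)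
      (exchanges [] (↭ₚ.∷↭∷ʳ _ (doubleᴱ Γ)) D))

⊸-elim′ : ∀ {Γ Δ τ} → Γ ⊢ M₁ ∶ τ ⊸ σ → Δ ⊢ M₂ ∶ ⌈ τ ⌉ → Consistent (Γ ++ Δ) →
          Γ ++ Δ ⊢ M₁ · M₂ ∶ σ
⊸-elim′ {M₁} {σ} {M₂} {Γ} {Δ} {τ} (b₁ , D₁) (b₂ , D₂) c = _ ,
  subst (_⊢[ _ ] M₁ · M₂ ∶ (σ , mty₂ σ)) (sym (map-++ _ Γ Δ))
    (⊸-elim D₁ (subst (λ s → doubleᴱ Δ ⊢[ b₂ ] M₂ ∶ (⌈ τ ⌉ , s)) (mty₂-⌈⌉ τ) D₂)
      (subst Consistent (map-++ _ Γ Δ) (consistent-doubleᴱ c)))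

⇒-elim′ : ∀ {Γ} {τs : Vec LTy (suc (suc n))} (Γs : Vec LEnv (suc (suc n))) →
          Γ ⊢ M₁ ∶ τs ⇒ σ → (∀ i → lookup Γs i ⊢ M₂ ∶ ⌈ lookup τs i ⌉) →
          Consistent (Γ ++ ∑ᴸ Γs) → Γ ++ ∑ᴸ Γs ⊢ M₁ · M₂ ∶ σ
⇒-elim′ {M₁ = M₁} {σ} {M₂} {Γ} {τs} Γs (b , D) Ds c = _ ,
  subst (_⊢[ _ ] M₁ · M₂ ∶ (σ , mty₂ σ)) (sym double-++)
    (⇒-elim {ts = Vec.map mty τs} {Γs = Vec.map doubleᴱ Γs} {bs = Vec.tabulate (proj₁ ∘ Ds)} D
      argument (subst Consistent double-++ (consistent-doubleᴱ c)))
  where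
  double-++ : doubleᴱ (Γ ++ ∑ᴸ Γs) ≡ doubleᴱ Γ ++ ∑ (Vec.map doubleᴱ Γs)
  double-++ = ≡.trans (map-++ _ Γ (∑ᴸ Γs)) (cong (doubleᴱ Γ ++_) (doubleᴱ-∑ Γs))
  argument : ∀ i → lookup (Vec.map doubleᴱ Γs) i ⊢[ lookup (Vec.tabulate (proj₁ ∘ Ds)) i ] M₂ ∶
                   (⌈ lookup τs i ⌉ , ⌈ lookup (Vec.map mty τs) i ⌉ᵐ)
  argument i
    rewrite lookup-map i doubleᴱ Γs | lookup∘tabulate (proj₁ ∘ Ds) i | lookup-map i mty τs
          | sym (mty₂-⌈⌉ (lookup τs i)) = proj₂ (Ds i)

-- Sharing of variables between function and argument

relabel : (Var → Var) → Decls A → Decls A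
relabel ρ = map (Product.map ρ id)

Shared : Decls A → Decls A → Var → Set
Shared Γ Δ x = x ∈ dom Γ × x ∈ dom Δ

-- `k` is meant to bound all names in use. A shared name then moves to `x + k`, which is at least
-- `k` and hence fresh, while an unshared one stays; names from `k` on are unconstrained.
Separates : ℕ → Decls A → Decls A → (Var → Var) → Set
Separates k Γ Δ ρ = ∀ {x} → x < k →
  (¬ Shared Γ Δ x × ρ x ≡ x) ⊎ (Shared Γ Δ x × ρ x ≡ x + k)

-- Names from k on are moved as well, to keep the renaming injective.
separator : ∀ k (Γ Δ : Decls A) → ∃[ ρ ] Injective _≡_ _≡_ ρ × Separates k Γ Δ ρ
separator k Γ Δ = ρ , ρ-injective , ρ-separates
  where
  shared? : Decidable (Shared Γ Δ)
  shared? x = (x ∈? dom Γ) ×-dec (x ∈? dom Δ)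
  ρ : Var → Var
  ρ x with x <? k | shared? x
  ... | yes _ | no _ = x
  ... | _     | _    = x + k
  view : ∀ x → (x < k × ¬ Shared Γ Δ x × ρ x ≡ x) ⊎ ((x < k → Shared Γ Δ x) × ρ x ≡ x + k)
  view x with x <? k | shared? x
  ... | yes x<k | no ¬sh = inj₁ (x<k , ¬sh , refl)
  ... | yes _   | yes sh = inj₂ ((λ _ → sh) , refl)
  ... | no x≮k  | yes sh = inj₂ ((λ _ → sh) , refl)
  ... | no x≮k  | no _   = inj₂ ((λ x<k → contradiction x<k x≮k) , refl)
  ρ-injective : Injective _≡_ _≡_ ρ
  ρ-injective {x} {y} eq with view x | view y
  ... | inj₁ (_ , _ , ex) | inj₁ (_ , _ , ey) = ≡.trans (sym ex) (≡.trans eq ey)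
  ... | inj₁ (x<k , _ , ex) | inj₂ (_ , ey) =
    contradiction (≡.trans (sym ex) (≡.trans eq ey)) (<⇒≢ (<-≤-trans x<k (m≤n+m k y)))
  ... | inj₂ (_ , ex) | inj₁ (y<k , _ , ey) =
    contradiction (≡.trans (sym ey) (≡.trans (sym eq) ex)) (<⇒≢ (<-≤-trans y<k (m≤n+m k x)))
  ... | inj₂ (_ , ex) | inj₂ (_ , ey) =
    +-cancelʳ-≡ k x y (≡.trans (sym ex) (≡.trans eq ey))
  ρ-separates : Separates k Γ Δ ρ
  ρ-separates {x} x<k with view x
  ... | inj₁ (_ , ¬sh , eq) = inj₁ (¬sh , eq)
  ... | inj₂ (sh , eq)      = inj₂ (sh x<k , eq)

<k⇒≢+k : ∀ {k y} x → y < k → y ≢ x + k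
<k⇒≢+k {k} x y<k = <⇒≢ (<-≤-trans y<k (m≤n+m k x))

-- Induction on `Γ`, with `Θ` collecting the declarations already treated. A variable missing from
-- `Δ` passes to `Θ` unchanged; a shared one is first contracted with its copy and deleted from `Δ`.
-- Once `Γ` is empty nothing is shared, so `ρ` is the identity below `k`, and `Δ` and `M₂` have
-- their own names back.
contract-shared : ∀ {k} Θ Γ {Δ ρ} →
  All (_< k) (fv M₁) → All (_< k) (fv M₂) → All (_< k) (dom Δ) → Separates k Γ Δ ρ →
  Consistent Δ → Consistent (Θ ++ Γ ++ relabel ρ Δ) →
  Θ ++ Γ ++ relabel ρ Δ ⊢ M₁ · rename ρ M₂ ∶ σ → Θ ++ (Γ ⊕ᴸ Δ) ⊢ M₁ · M₂ ∶ σ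
contract-shared {M₁} {M₂} {σ} {k} Θ [] {Δ} {ρ} M₁<k M₂<k Δ<k sep cΔ c D =
  subst₂ (λ Δ′ N → Θ ++ Δ′ ⊢ M₁ · N ∶ σ) env-eq term-eq D
  where
  fixes : ∀ {x} → x < k → ρ x ≡ x
  fixes x<k with sep x<k
  ... | inj₁ (_ , eq) = eq
  ... | inj₂ ((() , _) , _)
  env-eq : relabel ρ Δ ≡ [] ⊕ᴸ Δ
  env-eq = ≡.trans
    (map-id-local (All.tabulate λ {(x , a)} d∈ → cong (_, a) (fixes (All.lookup Δ<k (∈-map⁺ proj₁ d∈)))))
    (sym (merge-[] _⁺++⁺_ Δ))
  term-eq : rename ρ M₂ ≡ M₂
  term-eq = ≡.trans (rename-cong M₂ (All.map fixes M₂<k)) (rename-id M₂)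
contract-shared {M₁} {M₂} {σ} {k} Θ ((x , a) ∷ Γ) {Δ} {ρ} M₁<k M₂<k Δ<k sep cΔ c D =
  by-cases (x ∈? dom Δ)
  where
  c′ : Consistent ((x , a) ∷ Θ ++ Γ ++ relabel ρ Δ)
  c′ = Consistent-resp-↭ (↭ₚ.shift (x , a) Θ (Γ ++ relabel ρ Δ)) c

  x∉Γ : x ∉ dom Γ
  x∉Γ x∈Γ = Allₚ.All¬⇒¬Any (AllPairs.head c′)
    (subst (x ∈_) (sym (map-++ proj₁ Θ _))
      (∈-++⁺ʳ (dom Θ) (subst (x ∈_) (sym (map-++ proj₁ Γ _)) (∈-++⁺ˡ x∈Γ))))

  by-cases : Dec (x ∈ dom Δ) → Θ ++ (((x , a) ∷ Γ) ⊕ᴸ Δ) ⊢ M₁ · M₂ ∶ σ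

  by-cases (no x∉Δ) =
    subst (_⊢ M₁ · M₂ ∶ σ) (≡.trans (++-assoc Θ _ _) (cong (Θ ++_) (sym merge-eq)))
      (contract-shared (Θ ++ [ x , a ]) Γ M₁<k M₂<k Δ<k sep′ cΔ
        (subst Consistent assoc-eq c) (subst (_⊢ M₁ · rename ρ M₂ ∶ σ) assoc-eq D))
    where
    assoc-eq : Θ ++ (x , a) ∷ Γ ++ relabel ρ Δ ≡ (Θ ++ [ x , a ]) ++ Γ ++ relabel ρ Δ
    assoc-eq = sym (++-assoc Θ [ x , a ] _)
    merge-eq : ((x , a) ∷ Γ) ⊕ᴸ Δ ≡ (x , a) ∷ (Γ ⊕ᴸ Δ)
    merge-eq = ≡.trans (merge-∷ _⁺++⁺_ Γ Δ x∉Γ)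
      (cong₂ (λ o Δ′ → (x , maybe′ (a ⁺++⁺_) a o) ∷ (Γ ⊕ᴸ Δ′)) (assoc-∉ x∉Δ) (∖-∉ x∉Δ))
    sep′ : Separates k Γ Δ ρ
    sep′ y<k with sep y<k
    ... | inj₁ (¬sh , eq) = inj₁ (¬sh ∘ Product.map₁ there , eq)
    ... | inj₂ ((here refl , y∈Δ) , eq)  = contradiction y∈Δ x∉Δ
    ... | inj₂ ((there y∈Γ , y∈Δ) , eq) = inj₂ ((y∈Γ , y∈Δ) , eq)

  by-cases (yes x∈Δ) with c₀ , assoc-eq , ∈Δ ← assoc-∈ x∈Δ =
    subst (_⊢ M₁ · M₂ ∶ σ) (≡.trans (++-assoc Θ _ _) (cong (Θ ++_) (sym merge-eq)))
      (contract-shared (Θ ++ [ x , a ⁺++⁺ c₀ ]) Γ M₁<k M₂<k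
        (All.tabulate (λ y∈ → All.lookup Δ<k (proj₁ (∈-dom-∖⁻ Δ y∈))))
        sep′ (consistent-filter _ cΔ)
        (Consistent-resp-↭ after consistent)
        (exchange′ after
          (subst ((x , a ⁺++⁺ c₀) ∷ rest ⊢_∶ σ) term-eq (contraction′ (exchange′ before D) consistent))))
    where
    ρ′ : Var → Var
    -- Contraction gives the copy of `x` its original name back. As `x` leaves `Δ`, it is no longer
    -- shared and `ρ′` may fix it.
    ρ′ = ρ [ x ↦ x ]
    rest : LEnv
    rest = Θ ++ Γ ++ relabel ρ′ (Δ ∖ x)

    x<k : x < k
    x<k = All.lookup Δ<k x∈Δ
    ρx≡x+k : ρ x ≡ x + k
    ρx≡x+k with sep x<k
    ... | inj₁ (¬sh , _) = contradiction (here refl , x∈Δ) ¬sh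
    ... | inj₂ (_ , eq)  = eq

    merge-eq : ((x , a) ∷ Γ) ⊕ᴸ Δ ≡ (x , a ⁺++⁺ c₀) ∷ (Γ ⊕ᴸ (Δ ∖ x))
    merge-eq = ≡.trans (merge-∷ _⁺++⁺_ Γ Δ x∉Γ)
      (cong (λ o → (x , maybe′ (a ⁺++⁺_) a o) ∷ (Γ ⊕ᴸ (Δ ∖ x))) assoc-eq)

    relabel-∖ : relabel ρ (Δ ∖ x) ≡ relabel ρ′ (Δ ∖ x)
    relabel-∖ = map-cong-local (All.tabulate λ {(y , a′)} d∈ →
      cong (_, a′) (sym (↦-other ρ x (proj₂ (∈-dom-∖⁻ Δ (∈-map⁺ proj₁ d∈))))))

    relabel-↭ : relabel ρ Δ ↭ (ρ x , c₀) ∷ relabel ρ′ (Δ ∖ x)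
    relabel-↭ = subst (λ Δ′ → relabel ρ Δ ↭ (ρ x , c₀) ∷ Δ′) relabel-∖
      (↭ₚ.map⁺ (Product.map ρ id) (↭-∖ cΔ ∈Δ))

    -- `before` puts `x` and its copy `ρ x` side by side at the front for `contraction′`; `after`
    -- files the contracted declaration at the end of `Θ`.
    before : Θ ++ (x , a) ∷ Γ ++ relabel ρ Δ ↭ (x , a) ∷ (ρ x , c₀) ∷ rest
    before = trans (↭ₚ.shift (x , a) Θ (Γ ++ relabel ρ Δ)) (prep (x , a)
      (trans (↭ₚ.++⁺ˡ Θ (trans (↭ₚ.++⁺ˡ Γ relabel-↭) (↭ₚ.shift (ρ x , c₀) Γ _)))
             (↭ₚ.shift (ρ x , c₀) Θ _)))

    after : (x , a ⁺++⁺ c₀) ∷ rest ↭ (Θ ++ [ x , a ⁺++⁺ c₀ ]) ++ Γ ++ relabel ρ′ (Δ ∖ x)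
    after = trans (↭-sym (↭ₚ.shift _ Θ _)) (↭-reflexive (sym (++-assoc Θ _ _)))

    consistent : Consistent ((x , a ⁺++⁺ c₀) ∷ rest)
    -- Consistency depends on names only, and the contracted environment has those reached by
    -- `before` with `ρ x` dropped.
    consistent with (_ ∷ x∉) ∷ _ ∷ u ← Consistent-resp-↭ before c = x∉ ∷ u

    term-eq : (M₁ · rename ρ M₂) [ x / ρ x ] ≡ M₁ · rename ρ′ M₂
    term-eq = cong₂ _·_
      -- The name `ρ x` is `x + k`, too large to be free in `M₁`, so the contraction acts on the
      -- argument alone.
      ([/]-∉ x M₁ (All.map (λ y<k y≡ρx → <k⇒≢+k x y<k (≡.trans y≡ρx ρx≡x+k)) M₁<k))
      (rename-[/] ρ x M₂ (All.map only-x M₂<k))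
      where
      only-x : ∀ {y} → y < k → ρ y ≡ ρ x → y ≡ x
      only-x {y} y<k eq with sep y<k
      -- An unmoved `y` is below `k` and cannot equal `x + k`; a moved one satisfies
      -- `y + k ≡ x + k`.
      ... | inj₁ (_ , ρy≡y) =
        contradiction (≡.trans (sym ρy≡y) (≡.trans eq ρx≡x+k)) (<k⇒≢+k x y<k)
      ... | inj₂ (_ , ρy≡y+k) =
        +-cancelʳ-≡ k y x (≡.trans (sym ρy≡y+k) (≡.trans eq ρx≡x+k))

    sep′ : Separates k Γ (Δ ∖ x) ρ′
    sep′ {y} y<k with y ≟ x
    ... | yes refl = inj₁ ((λ (_ , y∈) → proj₂ (∈-dom-∖⁻ Δ y∈) refl) , refl)
    ... | no y≢x with sep y<k
    ...   | inj₁ (¬sh , eq) =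
      inj₁ ((λ (y∈Γ , y∈) → ¬sh (there y∈Γ , proj₁ (∈-dom-∖⁻ Δ y∈))) , eq)
    ...   | inj₂ ((here y≡x , _) , _) = contradiction y≡x y≢x
    ...   | inj₂ ((there y∈Γ , y∈Δ) , eq) = inj₂ ((y∈Γ , ∈-dom-∖⁺ Δ y∈Δ y≢x) , eq)

-- The elimination rules concatenate environments where inference merges them. The argument is
-- renamed apart by a separator, which makes the concatenation consistent, and `contract-shared`
-- then identifies the copies.
⊕-sound : ∀ {Γ Δ} → Consistent Γ → Consistent Δ →
  (∀ {ρ} → Injective _≡_ _≡_ ρ → Consistent (Γ ++ relabel ρ Δ) →
    Γ ++ relabel ρ Δ ⊢ M₁ · rename ρ M₂ ∶ σ) →
  Γ ⊕ᴸ Δ ⊢ M₁ · M₂ ∶ σ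
⊕-sound {M₁} {M₂} {σ} {Γ} {Δ} cΓ cΔ D =
  contract-shared [] Γ (Allₚ.++⁻ˡ (fv M₁) M<k) (Allₚ.++⁻ʳ (fv M₁) M<k)
    (Allₚ.++⁻ʳ (dom Γ) dom<k) separates cΔ consistent (D injective consistent)
  where
  names : List Var
  names = fv (M₁ · M₂) ++ dom Γ ++ dom Δ
  k : ℕ
  -- Strictly above the names of both terms as well as both environments: `x + k` has to be fresh
  -- for all of them.
  k = suc (max 0 names)
  names<k : All (_< k) names
  names<k = All.map s≤s (xs≤max 0 names)
  M<k : All (_< k) (fv (M₁ · M₂))
  M<k = Allₚ.++⁻ˡ (fv (M₁ · M₂)) names<k
  dom<k : All (_< k) (dom Γ ++ dom Δ)
  dom<k = Allₚ.++⁻ʳ (fv (M₁ · M₂)) names<k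
  ρ : Var → Var
  ρ = proj₁ (separator k Γ Δ)
  injective : Injective _≡_ _≡_ ρ
  injective = proj₁ (proj₂ (separator k Γ Δ))
  separates : Separates k Γ Δ ρ
  separates = proj₂ (proj₂ (separator k Γ Δ))
  disjoint : ∀ {x} → ¬ (x ∈ dom Γ × x ∈ map ρ (dom Δ))
  disjoint (x∈Γ , x∈) with y , y∈Δ , refl ← ∈-map⁻ ρ x∈
    with separates (All.lookup (Allₚ.++⁻ʳ (dom Γ) dom<k) y∈Δ)
  ... | inj₁ (¬sh , eq) = ¬sh (subst (_∈ dom Γ) eq x∈Γ , y∈Δ)
  ... | inj₂ (_ , eq)   = <k⇒≢+k y (All.lookup (Allₚ.++⁻ˡ (dom Γ) dom<k) x∈Γ) eq
  consistent : Consistent (Γ ++ relabel ρ Δ)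
  consistent = subst Unique
    (sym (≡.trans (map-++ proj₁ Γ _) (cong (dom Γ ++_) (dom-map ρ id Δ))))
    (Uniqueₚ.++⁺ cΓ (Uniqueₚ.map⁺ injective cΔ) disjoint)

-- Soundness of inference

consistent-subᴱ : ∀ S {Γ} → Consistent Γ → Consistent (subᴱ S Γ)
consistent-subᴱ S {Γ} = subst Unique (sym (≡.trans (dom-map id _ Γ) (map-id (dom Γ))))

consistent-instᴱ : ∀ f {ρ} → Injective _≡_ _≡_ ρ → ∀ {Γ} → Consistent Γ → Consistent (instᴱ f ρ Γ)
consistent-instᴱ f {ρ} inj {Γ} = subst Unique (sym (dom-map ρ _ Γ)) ∘ Uniqueₚ.map⁺ inj

consistent-∑ : (Γs : Vec LEnv n) → (∀ i → Consistent (lookup Γs i)) → Consistent (∑ᴸ Γs)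
consistent-∑ []       cs = []
consistent-∑ (Γ ∷ Γs) cs =
  consistent-merge _⁺++⁺_ {Γ} (cs Fin.zero) (consistent-∑ Γs (cs ∘ Fin.suc))

infer-consistent : ∀ {M V Γ σ b} → Infer M V Γ σ b → Consistent Γ
infer-consistent fvar            = [] ∷ []
infer-consistent (abs-⊸ I _)     = consistent-filter _ (infer-consistent I)
infer-consistent (abs-⇒ I _)     = consistent-filter _ (infer-consistent I)
infer-consistent (app-var {Γ₁ = Γ₁} {S = S} I₁ I₂ _ _) = consistent-subᴱ S
  (consistent-merge _⁺++⁺_ {Γ₁} (infer-consistent I₁) (infer-consistent I₂))
infer-consistent (app-⇒ {Γ₁ = Γ₁} {Γs = Γs} {S = S} I₁ Is _ _) = consistent-subᴱ S
  (consistent-merge _⁺++⁺_ {Γ₁} (infer-consistent I₁) (consistent-∑ Γs (infer-consistent ∘ Is)))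
infer-consistent (app-⊸ {Γ₁ = Γ₁} {S = S} I₁ I₂ _ _) = consistent-subᴱ S
  (consistent-merge _⁺++⁺_ {Γ₁} (infer-consistent I₁) (infer-consistent I₂))
infer-consistent (conv I Γ≈ _)   = subst Unique (dom-≈ Γ≈) (infer-consistent I)
  where
  dom-≈ : ∀ {Γ Γ′} → Γ ≈ᴸᴱ Γ′ → dom Γ ≡ dom Γ′
  dom-≈ []                = refl
  dom-≈ ((refl , _) ∷ Γ≈) = cong (_ ∷_) (dom-≈ Γ≈)

relabel-instᴱ : ∀ f ρ′ ρ Γ → relabel ρ′ (instᴱ f ρ Γ) ≡ instᴱ f (ρ′ ∘ ρ) Γ
relabel-instᴱ f ρ′ ρ Γ = sym (map-∘ Γ)

-- The part common to the three application rules: `f` after the unifier `S` is absorbed into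
-- `f ⊙ S`. The argument gets its own renaming in the premise because separation is applied on top
-- of `ρ`, giving the composite `ρ′ ∘ ρ`, again injective.
application-sound : ∀ f S {ρ} → Injective _≡_ _≡_ ρ → ∀ {Γ Δ} → Consistent Γ → Consistent Δ →
  (∀ {ρ′} → Injective _≡_ _≡_ ρ′ → Consistent (instᴱ (f ⊙ S) ρ Γ ++ instᴱ (f ⊙ S) ρ′ Δ) →
    instᴱ (f ⊙ S) ρ Γ ++ instᴱ (f ⊙ S) ρ′ Δ ⊢ rename ρ M₁ · rename ρ′ M₂ ∶ inst₂ (f ⊙ S) σ) →
  instᴱ f ρ (subᴱ S (Γ ⊕ᴸ Δ)) ⊢ rename ρ (M₁ · M₂) ∶ inst₂ f (sub₂ S σ)
application-sound {M₁} {M₂} {σ} f S {ρ} inj {Γ} {Δ} cΓ cΔ D =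
  subst₂ (_⊢ rename ρ (M₁ · M₂) ∶_)
    (sym (≡.trans (instᴱ-sub f ρ S (Γ ⊕ᴸ Δ)) (instᴱ-⊕ (f ⊙ S) inj Γ Δ)))
    (sym (inst₂-sub f S σ))
    (⊕-sound (consistent-instᴱ (f ⊙ S) inj cΓ) (consistent-instᴱ (f ⊙ S) inj cΔ) separated)
  where
  separated : ∀ {ρ′} → Injective _≡_ _≡_ ρ′ →
    Consistent (instᴱ (f ⊙ S) ρ Γ ++ relabel ρ′ (instᴱ (f ⊙ S) ρ Δ)) →
    instᴱ (f ⊙ S) ρ Γ ++ relabel ρ′ (instᴱ (f ⊙ S) ρ Δ) ⊢
      rename ρ M₁ · rename ρ′ (rename ρ M₂) ∶ inst₂ (f ⊙ S) σ
  separated {ρ′} inj′ c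
    rewrite relabel-instᴱ (f ⊙ S) ρ′ ρ Δ | rename-∘ ρ′ ρ M₂ = D (inj ∘ inj′) c

infer-sound : ∀ {M V Γ σ b} → Infer M V Γ σ b → ∀ f {ρ} → Injective _≡_ _≡_ ρ →
              instᴱ f ρ Γ ⊢ rename ρ M ∶ inst₂ f σ
infer-sound (fvar {α = α}) f inj = axiom′ (f α)
infer-sound (abs-⊸ {x} {M₁} {Γ₁ = Γ₁} {τ} {σ₁} I x∈) f {ρ} inj =
  subst (λ N → instᴱ f ρ (Γ₁ ∖ x) ⊢ ƛ N ∶ inst₂ f (τ ⊸ σ₁)) (sym (rename-close inj x M₁))
    (⊸-intro′ (exchange′ (↭ₚ.map⁺ _ (↭-∖ (infer-consistent I) x∈)) (infer-sound I f inj)))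
infer-sound (abs-⇒ {x = x} {M₁} {Γ₁ = Γ₁} {τs} {σ₁} I x∈) f {ρ} inj =
  subst (λ N → instᴱ f ρ (Γ₁ ∖ x) ⊢ ƛ N ∶ inst₂ f (τs ⇒ σ₁)) (sym (rename-close inj x M₁))
    (⇒-intro′ (subst (λ τ⃗ → (ρ x , τ⃗) ∷ instᴱ f ρ (Γ₁ ∖ x) ⊢ rename ρ M₁ ∶ inst₂ f σ₁)
      (map-fromVec (inst f) τs)
      (exchange′ (↭ₚ.map⁺ _ (↭-∖ (infer-consistent I) x∈)) (infer-sound I f inj))))
infer-sound (app-var {M₁} {M₂} {Γ₁ = Γ₁} {Γ₂} {α₁} {α₂} {α₃} {τ₂} {S = S} I₁ I₂ _ U) f {ρ} inj
  with u₁ ∷ u₂ ∷ [] ← unifyQ-unifies U f =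
  application-sound {M₁} {M₂} {var α₃} f S inj (infer-consistent I₁) (infer-consistent I₂)
    λ {ρ′} inj′ → ⊸-elim′
      -- `u₁` exposes the instance of `α₁` as the arrow `g α₂ ⊸ g α₃`, and `u₂` identifies the type
      -- of the argument with its domain `g α₂`.
      (subst (λ τ → instᴱ g ρ Γ₁ ⊢ rename ρ M₁ ∶ ⌈ τ ⌉) u₁ (infer-sound I₁ g inj))
      (subst (instᴱ g ρ′ Γ₂ ⊢ rename ρ′ M₂ ∶_) (≡.trans (inst₂-⌈⌉ g τ₂) (cong ⌈_⌉ u₂))
        (infer-sound I₂ g inj′))
  where
  g : Instance
  g = f ⊙ S
infer-sound (app-⇒ {n} {M₁} {M₂} {Γ₁ = Γ₁} {τs′} {σ₁} {Γs = Γs} {τs} {S = S} I₁ Is _ U) f {ρ} inj =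
  application-sound {M₁} {M₂} {σ₁} f S inj
    (infer-consistent I₁) (consistent-∑ Γs (infer-consistent ∘ Is)) separated
  where
  g : Instance
  g = f ⊙ S
  argument : ∀ {ρ′} → Injective _≡_ _≡_ ρ′ → ∀ i →
    lookup (Vec.map (instᴱ g ρ′) Γs) i ⊢ rename ρ′ M₂ ∶ ⌈ lookup (Vec.map (inst g) τs′) i ⌉
  argument {ρ′} inj′ i
    rewrite lookup-map i (instᴱ g ρ′) Γs | sym (unifies-zipWith τs τs′ (unifyQ-unifies U f))
          | lookup-map i (inst g) τs | sym (inst₂-⌈⌉ g (lookup τs i)) = infer-sound (Is i) g inj′
  separated : ∀ {ρ′} → Injective _≡_ _≡_ ρ′ → Consistent (instᴱ g ρ Γ₁ ++ instᴱ g ρ′ (∑ᴸ Γs)) →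
    instᴱ g ρ Γ₁ ++ instᴱ g ρ′ (∑ᴸ Γs) ⊢ rename ρ M₁ · rename ρ′ M₂ ∶ inst₂ g σ₁
  -- All copies of the argument are typed under the same `ρ′`, so the sum of the renamed
  -- environments is the renamed sum.
  separated {ρ′} inj′ c rewrite instᴱ-∑ g inj′ Γs =
    ⇒-elim′ (Vec.map (instᴱ g ρ′) Γs) (infer-sound I₁ g inj) (argument inj′) c
infer-sound (app-⊸ {M₁} {M₂} {Γ₁ = Γ₁} {Γ₂} {τ} {τ₂} {σ₁} {S = S} I₁ I₂ _ U) f {ρ} inj
  with u ∷ [] ← unifyQ-unifies U f =
  application-sound {M₁} {M₂} {σ₁} f S inj (infer-consistent I₁) (infer-consistent I₂)
    λ {ρ′} inj′ → ⊸-elim′ (infer-sound I₁ g inj)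
      (subst (instᴱ g ρ′ Γ₂ ⊢ rename ρ′ M₂ ∶_) (≡.trans (inst₂-⌈⌉ g τ₂) (cong ⌈_⌉ u))
        (infer-sound I₂ g inj′))
  where
  g : Instance
  g = f ⊙ S
infer-sound (conv I Γ≈ σ≈) f {ρ} inj =
  conv′ (infer-sound I f inj) (instᴱ-≈ f ρ Γ≈) (inst₂-≈ f σ≈)

infer-typable : ∀ {M V Γ σ b} → Infer M V Γ σ b → Γ ⊢ M ∶ σ
infer-typable {M} {Γ = Γ} {σ} I =
  subst (λ N → Γ ⊢ N ∶ σ) (rename-id M)
    (subst₂ (_⊢ rename id M ∶_) (instᴱ-var Γ) (inst₂-var σ) (infer-sound I var id))

doubleᴱ-zip : (xs : Vec Var n) (τ⃗s : Vec LSeq n) →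
              doubleᴱ (toList (zip xs τ⃗s)) ≡ toList (zip xs (zip τ⃗s (Vec.map (List⁺.map mty) τ⃗s)))
doubleᴱ-zip []       []        = refl
doubleᴱ-zip (x ∷ xs) (τ⃗ ∷ τ⃗s) = cong (_ ∷_) (doubleᴱ-zip xs τ⃗s)

theorem54 : ∀ {n} (M : Λ) (xs : Vec Var n) (τ⃗s : Vec LSeq n) (σ : LTy₂) (b : ℕ) →
    TQ M ↦ (toList (zip xs τ⃗s) , σ , b) →
    ∃[ b′ ] ∃[ s ] ∃[ t⃗s ] toList (zip xs (zip {n = n} τ⃗s t⃗s)) ⊢[ b′ ] M ∶ (σ , s)
theorem54 M xs τ⃗s σ b (V , I) with b′ , D ← infer-typable I =
  b′ , mty₂ σ , Vec.map (List⁺.map mty) τ⃗s ,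
  subst (_⊢[ b′ ] M ∶ (σ , mty₂ σ)) (doubleᴱ-zip xs τ⃗s) D
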